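{- Let $n\ge 2$ be an integer and let $M(C_{2n})$ denote the middle graph of the cycle $C_{2n}$ on $2n$ vertices. If $G$ is a finite connected graph which satisfies the odd two-pebbling property, then $$f(M(C_{2n})\times G)\leq f(M(C_{2n}))\,f(G)=(2^{n+1}+2n-2)\,f(G).$$
   Context: All graphs are finite, simple and connected. A distribution of pebbles on a graph assigns to each vertex a nonnegative integer number of pebbles. A pebbling move removes two pebbles from one vertex and places one pebble on an adjacent vertex. The pebbling number $f(G)$ is the least integer $p$ such that, from every distribution of $p$ pebbles on the vertices of $G$ and for every target vertex $v$ of $G$, it is possible by a (possibly empty) sequence of pebbling moves to place at least one pebble on $v$. A graph $G$ satisfies the odd two-pebbling property if, for every distribution of $p$ pebbles on $G$ in which exactly $r$ vertices carry an odd number of pebbles and $p>2f(G)-r$, and for every vertex $v$ of $G$, it is possible by a sequence of pebbling moves to have at least two pebbles on $v$. The middle graph $M(G)$ of a graph $G$ is obtained from $G$ by inserting a new vertex into each edge of $G$ (subdividing the edge), and joining two new vertices by an edge whenever the two edges of $G$ into which they were inserted share a vertex of $G$. Explicitly, $M(C_{2n})$ has vertices $v_0,\dots,v_{2n-1},u_0,\dots,u_{2n-1}$ and edges $v_iu_i$, $u_iv_{i+1}$, $u_iu_{i+1}$ for $0\le i\le 2n-1$, indices modulo $2n$. The Cartesian product $G\times H$ has vertex set $V(G)\times V(H)$; its edges are the pairs $\{(a,v),(b,v)\}$ with $\{a,b\}\in E(G)$, $v\in V(H)$, and the pairs $\{(u,x),(u,y)\}$ with $u\in V(G)$, $\{x,y\}\in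 E(H)$. -}

module Defs where

open import Data.Empty using (⊥-elim)
open import Data.Fin using (Fin; toℕ; fromℕ<)
import Data.Fin.Properties as Fin
open import Data.List using (List; []; _∷_; _++_; map; length; filter; allFin;
  cartesianProduct; cartesianProductWith; upTo)
open import Data.List.Membership.Propositional using (_∈_; find; lose)
open import Data.List.Membership.Propositional.Properties using
  (∈-map⁺; ∈-map⁻; ∈-++⁺ˡ; ∈-++⁺ʳ; ∈-allFin; ∈-cartesianProduct⁺;
   ∈-cartesianProductWith⁺; ∈-upTo⁺)
open import Data.List.Relation.Unary.All as All using (All; []; _∷_)
open import Data.List.Relation.Unary.AllPairs using ([]; _∷_)
open import Data.List.Relation.Unary.Any as Any using (Any; here; there)
open import Data.List.Relation.Unary.Unique.Propositional using (Unique)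
import Data.List.Relation.Unary.Unique.Propositional.Properties as Uniqueₚ
open import Data.Nat using (ℕ; zero; suc; _+_; _*_; _∸_; _^_; _≤_; _<_; z≤n; s≤s;
  _≤?_)
open import Data.Nat.ListAction using (sum)
import Data.Nat as ℕ
open import Data.Nat.Divisibility using (_∣?_)
open import Data.Nat.DivMod using (_mod_; _%_; m<n⇒m%n≡m; n%n≡0; m%n<n)
open import Data.Nat.Properties hiding (_≟_)
open import Data.Product using (Σ; ∃; _×_; _,_; proj₁; proj₂)
open import Data.Product.Properties using (≡-dec)
open import Data.Sum using (_⊎_; inj₁; inj₂)
open import Function using (_∘_)
open import Relation.Binary.Construct.Closure.ReflexiveTransitive as Star
  using (Star; ε; _◅_; _◅◅_)
open import Relation.Binary.Construct.Closure.Symmetric as Sym using (SymClosure; fwd; bwd)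
open import Relation.Binary.Definitions using (DecidableEquality; tri<; tri≈; tri>)
open import Relation.Binary.PropositionalEquality
open import Relation.Nullary using (¬_; Dec; yes; no; ¬?)
open import Relation.Nullary.Decidable using (map′; _×-dec_; _⊎-dec_; _→-dec_)

-- Finite simple connected graphs.  Finiteness is a repetition-free list of
-- all vertices; only the truth of `Adj u v` matters, not its proofs, so there
-- are no multiple edges.
record Graph : Set₁ where
  infix 4 _≟_
  field
    V         : Set
    _≟_       : DecidableEquality V
    vertices  : List V
    unique    : Unique vertices
    complete  : ∀ v → v ∈ vertices
    Adj       : V → V → Set
    adj?      : ∀ u v → Dec (Adj u v)
    symmetric : ∀ {u v} → Adj u v → Adj v u
    loopless  : ∀ {v} → ¬ Adj v v
    connected : ∀ u v → Star Adj u v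

module _ (G : Graph) where
  open Graph G

  Distribution : Set
  Distribution = V → ℕ

  size : Distribution → ℕ
  size D = sum (map D vertices)

  oddCount : Distribution → ℕ
  oddCount D = length (filter (λ v → ¬? (2 ∣? D v)) vertices)

  -- Functions are compared pointwise, as there is no function extensionality.
  record Move (D D′ : Distribution) : Set where
    constructor move
    field
      {source target} : V
      adjacent : Adj source target
      remove   : D source ≡ 2 + D′ source
      add      : D′ target ≡ 1 + D target
      other    : ∀ w → w ≢ source → w ≢ target → D′ w ≡ D w

  CanPlace : ℕ → V → Distribution → Set
  CanPlace k v D = ∃ λ D′ → Star Move D D′ × k ≤ D′ v

  Suffices : ℕ → Set
  Suffices p = ∀ D → size D ≡ p → ∀ v → CanPlace 1 v D

  IsPebblingNumber : ℕ → Set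
  IsPebblingNumber p = Suffices p × (∀ q → Suffices q → p ≤ q)

-- Existence of the pebbling number: solvability is decidable by exhaustive
-- search, and connectedness bounds the number of pebbles needed.
module Existence (G : Graph) where
  open Graph G

  sum-change : ∀ {D E : V → ℕ} {u c} xs → Unique xs → u ∈ xs → E u ≡ c + D u →
    (∀ w → w ≢ u → E w ≡ D w) → sum (map E xs) ≡ c + sum (map D xs)
  sum-change {D} {E} {u} {c} (x ∷ xs) (x∉ ∷ _) (here refl) eq same =
    trans (cong₂ _+_ eq (agree xs x∉)) (+-assoc c (D u) _)
    where
    agree : ∀ ys → All (u ≢_) ys → sum (map E ys) ≡ sum (map D ys)
    agree []       []        = refl
    agree (y ∷ ys) (u≢y ∷ r) = cong₂ _+_ (same y (u≢y ∘ sym)) (agree ys r)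
  sum-change {D} {E} {u} {c} (x ∷ xs) (x∉ ∷ un) (there u∈) eq same =
    trans (cong₂ _+_ (same x (All.lookup x∉ u∈)) (sum-change xs un u∈ eq same))
    (trans (sym (+-assoc (D x) c _))
    (trans (cong (_+ sum (map D xs)) (+-comm (D x) c)) (+-assoc c (D x) _)))

  upd : V → ℕ → (V → ℕ) → (V → ℕ)
  upd u k D w with w ≟ u
  ... | yes _ = k
  ... | no  _ = D w

  upd-same : ∀ u k D → upd u k D u ≡ k
  upd-same u k D with u ≟ u
  ... | yes _ = refl
  ... | no ≢  = ⊥-elim (≢ refl)

  upd-other : ∀ u k D w → w ≢ u → upd u k D w ≡ D w
  upd-other u k D w w≢u with w ≟ u
  ... | yes w≡u = ⊥-elim (w≢u w≡u)
  ... | no _    = refl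

  adj⇒≢ : ∀ {u v} → Adj u v → u ≢ v
  adj⇒≢ a refl = loopless a

  shift : V → V → (V → ℕ) → (V → ℕ)
  shift u v D = upd v (1 + D v) (upd u (D u ∸ 2) D)

  shift-source : ∀ {u v} D → Adj u v → shift u v D u ≡ D u ∸ 2
  shift-source {u} {v} D a =
    trans (upd-other v _ _ u (adj⇒≢ a)) (upd-same u _ D)

  shift-move : ∀ {u v} D → Adj u v → 2 ≤ D u → Move G D (shift u v D)
  shift-move {u} {v} D a 2≤ = move a
    (trans (sym (m+[n∸m]≡n 2≤)) (cong (2 +_) (sym (shift-source D a))))
    (upd-same v _ _)
    (λ w w≢u w≢v → trans (upd-other v _ _ w w≢v) (upd-other u _ D w w≢u))

  move-source : ∀ {D D′} (m : Move G D D′) → 2 ≤ D (Move.source m)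
  move-source m = subst (2 ≤_) (sym (Move.remove m)) (s≤s (s≤s z≤n))

  move-shift : ∀ {D D′} (m : Move G D D′) →
    D′ ≗ shift (Move.source m) (Move.target m) D
  move-shift {D} {D′} (move {u} {v} a r p o) w with w ≟ v
  ... | yes refl = p
  ... | no w≢v with w ≟ u
  ...   | yes refl = sym (cong (_∸ 2) r)
  ...   | no w≢u   = o w w≢u w≢v

  move-size : ∀ {D D′} → Move G D D′ → size G D ≡ suc (size G D′)
  move-size {D} {D′} (move {u} {v} a r p o) =
    trans (sum-change {E = D} {c = 2} vertices unique (complete u) source-change source-same)
          (cong suc (sym (sum-change {E = D′} {c = 1} vertices unique (complete v) target-change target-same)))
    where
    D₀ : V → ℕ
    D₀ = upd u (D′ u) D
    source-change : D u ≡ 2 + D₀ u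
    source-change = trans r (cong (2 +_) (sym (upd-same u _ D)))
    source-same : ∀ w → w ≢ u → D w ≡ D₀ w
    source-same w w≢u = sym (upd-other u _ D w w≢u)
    target-change : D′ v ≡ 1 + D₀ v
    target-change = trans p (cong suc (sym (upd-other u _ D v (adj⇒≢ a ∘ sym))))
    target-same : ∀ w → w ≢ v → D′ w ≡ D₀ w
    target-same w w≢v with w ≟ u
    ... | yes refl = refl
    ... | no w≢u   = o w w≢u w≢v

  canPlace-resp : ∀ {k v D E} → D ≗ E → CanPlace G k v D → CanPlace G k v E
  canPlace-resp {k} {v} eq (_ , ε , k≤) = _ , ε , subst (k ≤_) (eq v) k≤
  canPlace-resp {E = E} eq (F , move {u} {w} a r p o ◅ ms , k≤) =
    F , move a (trans (sym (eq u)) r) (trans p (cong suc (eq w)))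
          (λ x x≢u x≢w → trans (o x x≢u x≢w) (eq x)) ◅ ms , k≤

  canPlace? : ∀ k v s D → size G D ≡ s → Dec (CanPlace G k v D)
  canPlace? k v s D eq with k ≤? D v
  ... | yes k≤ = yes (D , ε , k≤)
  canPlace? k v zero D eq | no k≰ = no λ
    { (_ , ε , k≤) → k≰ k≤
    ; (_ , m ◅ _ , _) → 0≢1+n (trans (sym eq) (move-size m)) }
  canPlace? k v (suc s) D eq | no k≰ =
    map′ from to (Any.any? (λ u → Any.any? (step? u) vertices) vertices)
    where
    Step : V → V → Set
    Step u w = Adj u w × Σ (2 ≤ D u) λ _ → CanPlace G k v (shift u w D)
    step? : ∀ u w → Dec (Step u w)
    step? u w with adj? u w | 2 ≤? D u
    ... | no ¬a | _      = no (¬a ∘ proj₁)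
    ... | yes _ | no ¬2≤ = no (¬2≤ ∘ proj₁ ∘ proj₂)
    ... | yes a | yes 2≤ = map′ (λ c → a , 2≤ , c) (proj₂ ∘ proj₂)
      (canPlace? k v s (shift u w D)
        (suc-injective (trans (sym (move-size (shift-move D a 2≤))) eq)))
    from : Any (λ u → Any (Step u) vertices) vertices → CanPlace G k v D
    from any with u , _ , any′ ← find any with w , _ , a , 2≤ , E , ms , k≤ ← find any′ =
      E , shift-move D a 2≤ ◅ ms , k≤
    to : CanPlace G k v D → Any (λ u → Any (Step u) vertices) vertices
    to (_ , ε , k≤) = ⊥-elim (k≰ k≤)
    to (E , m ◅ ms , k≤) = lose (complete (Move.source m)) (lose (complete (Move.target m))
      (Move.adjacent m , move-source m , canPlace-resp (move-shift m) (E , ms , k≤)))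

  functions : ℕ → List V → List (V → ℕ)
  functions p []       = (λ _ → 0) ∷ []
  functions p (x ∷ xs) = cartesianProductWith (upd x) (upTo (suc p)) (functions p xs)

  functions-complete : ∀ p xs (D : V → ℕ) → (∀ v → D v ≤ p) →
    ∃ λ (E : V → ℕ) → E ∈ functions p xs × (∀ v → v ∈ xs → D v ≡ E v)
  functions-complete p []       D ≤p = _ , here refl , λ _ ()
  functions-complete p (x ∷ xs) D ≤p with E , E∈ , eq ← functions-complete p xs D ≤p =
    upd x (D x) E , ∈-cartesianProductWith⁺ (upd x) (∈-upTo⁺ (s≤s (≤p x))) E∈ , agree
    where
    agree : ∀ v → v ∈ x ∷ xs → D v ≡ upd x (D x) E v
    agree v v∈ with v ≟ x
    agree v v∈          | yes refl = refl
    agree v (here v≡x)  | no v≢x = ⊥-elim (v≢x v≡x)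
    agree v (there v∈)  | no v≢x = eq v v∈

  term≤sum : ∀ {D : V → ℕ} {v xs} → v ∈ xs → D v ≤ sum (map D xs)
  term≤sum {D} (here refl)          = m≤m+n _ _
  term≤sum {D} {xs = x ∷ _} (there v∈) = ≤-trans (term≤sum v∈) (m≤n+m _ (D x))

  size-resp : ∀ {D E} → D ≗ E → size G D ≡ size G E
  size-resp {D} {E} eq = go vertices
    where
    go : ∀ xs → sum (map D xs) ≡ sum (map E xs)
    go []       = refl
    go (x ∷ xs) = cong₂ _+_ (eq x) (go xs)

  suffices? : ∀ p → Dec (Suffices G p)
  suffices? p = map′ from to (All.all? good? (functions p vertices))
    where
    Good : (V → ℕ) → Set
    Good D = size G D ≡ p → All (λ v → CanPlace G 1 v D) vertices
    good? : ∀ D → Dec (Good D)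
    good? D = (size G D ℕ.≟ p) →-dec
      All.all? (λ v → canPlace? 1 v (size G D) D refl) vertices
    from : All Good (functions p vertices) → Suffices G p
    from all D eq v
      with E , E∈ , D≗E ← functions-complete p vertices D
             (λ w → subst (D w ≤_) eq (term≤sum (complete w))) =
      canPlace-resp (λ w → sym (D≗E w (complete w)))
        (All.lookup (All.lookup all E∈
          (trans (sym (size-resp (λ w → D≗E w (complete w)))) eq)) (complete v))
    to : Suffices G p → All Good (functions p vertices)
    to s = All.universal (λ D eq → All.universal (s D eq) vertices) _

  transfer : ∀ {u w} k D → Adj u w → 2 * k ≤ D u →
    ∃ λ D′ → Star (Move G) D D′ × k + D w ≤ D′ w
  transfer zero D a _ = D , ε , ≤-refl
  transfer {u} {w} (suc k) D a 2k≤
    with E , ms , k≤ ← transfer k (shift u w D) a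
      (subst (2 * k ≤_) (sym (shift-source D a))
        (∸-monoˡ-≤ 2 (subst (_≤ D u) (*-suc 2 k) 2k≤))) =
    E , shift-move D a (≤-trans (*-monoʳ-≤ 2 (s≤s (z≤n {k}))) 2k≤) ◅ ms ,
    subst (_≤ E w) (trans (cong (k +_) (upd-same w _ _)) (+-suc k (D w))) k≤

  walkLength : ∀ {u v} → Star Adj u v → ℕ
  walkLength ε       = 0
  walkLength (_ ◅ w) = suc (walkLength w)

  along : ∀ {u v} (π : Star Adj u v) D → 2 ^ walkLength π ≤ D u → CanPlace G 1 v D
  along ε D ≤Du = D , ε , ≤Du
  along (a ◅ π) D ≤Du with E , ms , ≤E ← transfer (2 ^ walkLength π) D a ≤Du
    with F , ns , ≤F ← along π E (≤-trans (m≤m+n _ _) ≤E) = F , ms ◅◅ ns , ≤F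

  cost : V → V → ℕ
  cost u v = 2 ^ walkLength (connected u v)

  maxCost : ℕ
  maxCost = sum (map (λ u → sum (map (cost u) vertices)) vertices)

  cost≤maxCost : ∀ u v → cost u v ≤ maxCost
  cost≤maxCost u v =
    ≤-trans (term≤sum {cost u} (complete v))
            (term≤sum {λ u → sum (map (cost u) vertices)} (complete u))

  pigeonhole : ∀ (D : V → ℕ) b xs → length xs * b < sum (map D xs) → ∃ λ u → b ≤ D u
  pigeonhole D b (x ∷ xs) lt with b ≤? D x
  ... | yes b≤ = x , b≤
  ... | no b≰  = pigeonhole D b xs (+-cancelˡ-< b _ _
    (<-≤-trans lt (+-monoˡ-≤ _ (<⇒≤ (≰⇒> b≰)))))

  bound : ℕ
  bound = suc (length vertices * maxCost)

  bound-suffices : Suffices G bound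
  bound-suffices D eq v with u , ≤Du ← pigeonhole D maxCost vertices (≤-reflexive (sym eq)) =
    along (connected u v) D (≤-trans (cost≤maxCost u v) ≤Du)

  least : ∀ {P : ℕ → Set} → (∀ n → Dec (P n)) → ∀ n → P n →
    ∃ λ m → P m × (∀ q → P q → m ≤ q)
  least P? zero    Pn = 0 , Pn , λ _ _ → z≤n
  least P? (suc n) Pn with P? 0
  ... | yes P0 = 0 , P0 , λ _ _ → z≤n
  ... | no ¬P0 with m , Pm , min ← least (P? ∘ suc) n Pn =
    suc m , Pm , λ { zero P0 → ⊥-elim (¬P0 P0) ; (suc q) Pq → s≤s (min q Pq) }

abstract
  pebblingNumber-exists : ∀ G → ∃ (IsPebblingNumber G)
  pebblingNumber-exists G = least suffices? bound bound-suffices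
    where open Existence G

f : Graph → ℕ
f G = proj₁ (pebblingNumber-exists G)

f-isPebblingNumber : ∀ G → IsPebblingNumber G (f G)
f-isPebblingNumber G = proj₂ (pebblingNumber-exists G)

-- The inequality p > 2 f(G) − r is taken over the integers, hence written
-- additively rather than with truncated subtraction.
OddTwoPebbling : Graph → Set
OddTwoPebbling G = ∀ (D : Distribution G) →
  size G D + oddCount G D ℕ.> 2 * f G → ∀ v → CanPlace G 2 v D

infixr 7 _□_

_□_ : Graph → Graph → Graph
G □ H = record
  { V         = G.V × H.V
  ; _≟_       = ≡-dec G._≟_ H._≟_
  ; vertices  = cartesianProduct G.vertices H.vertices
  ; unique    = Uniqueₚ.cartesianProduct⁺ G.unique H.unique
  ; complete  = λ (a , x) → ∈-cartesianProduct⁺ (G.complete a) (H.complete x)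
  ; Adj       = λ (a , x) (b , y) → (G.Adj a b × x ≡ y) ⊎ (a ≡ b × H.Adj x y)
  ; adj?      = λ (a , x) (b , y) →
                  (G.adj? a b ×-dec (x H.≟ y)) ⊎-dec ((a G.≟ b) ×-dec H.adj? x y)
  ; symmetric = λ { (inj₁ (e , refl)) → inj₁ (G.symmetric e , refl)
                  ; (inj₂ (refl , e)) → inj₂ (refl , H.symmetric e) }
  ; loopless  = λ { (inj₁ (e , _)) → G.loopless e ; (inj₂ (_ , e)) → H.loopless e }
  ; connected = λ (a , x) (b , y) →
                  Star.gmap (_, x) (λ e → inj₁ (e , refl)) (G.connected a b) ◅◅
                  Star.gmap (b ,_) (λ e → inj₂ (refl , e)) (H.connected x y)
  }
  where
  module G = Graph G
  module H = Graph H

-- i ↦ i + 1 modulo k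
next : ∀ {k} → Fin k → Fin k
next {suc k} i = suc (toℕ i) mod suc k

-- v i are the vertices of the cycle C_k, and u i is inserted into the edge
-- joining v i to v (next i).
data MiddleVertex (k : ℕ) : Set where
  v u : Fin k → MiddleVertex k

data MiddleEdge {k : ℕ} : MiddleVertex k → MiddleVertex k → Set where
  v—u  : ∀ {i j} → j ≡ i      → MiddleEdge (v i) (u j)
  u—v⁺ : ∀ {i j} → j ≡ next i → MiddleEdge (u i) (v j)
  u—u⁺ : ∀ {i j} → j ≡ next i → MiddleEdge (u i) (u j)

module MiddleCycle (k : ℕ) where

  _≟ᴹ_ : DecidableEquality (MiddleVertex k)
  v i ≟ᴹ v j = map′ (cong v) (λ { refl → refl }) (i Fin.≟ j)
  v i ≟ᴹ u j = no λ ()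
  u i ≟ᴹ v j = no λ ()
  u i ≟ᴹ u j = map′ (cong u) (λ { refl → refl }) (i Fin.≟ j)

  edge? : ∀ x y → Dec (MiddleEdge {k} x y)
  edge? (v i) (v j) = no λ ()
  edge? (v i) (u j) = map′ v—u (λ { (v—u e) → e }) (j Fin.≟ i)
  edge? (u i) (v j) = map′ u—v⁺ (λ { (u—v⁺ e) → e }) (j Fin.≟ next i)
  edge? (u i) (u j) = map′ u—u⁺ (λ { (u—u⁺ e) → e }) (j Fin.≟ next i)

  all : List (MiddleVertex k)
  all = map v (allFin k) ++ map u (allFin k)

  all-unique : Unique all
  all-unique = Uniqueₚ.++⁺ (Uniqueₚ.map⁺ (λ { refl → refl }) (Uniqueₚ.allFin⁺ k))
                           (Uniqueₚ.map⁺ (λ { refl → refl }) (Uniqueₚ.allFin⁺ k)) disjoint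
    where
    disjoint : ∀ {x} → ¬ (x ∈ map v (allFin k) × x ∈ map u (allFin k))
    disjoint (p , q) with _ , _ , refl ← ∈-map⁻ v p with _ , _ , () ← ∈-map⁻ u q

  all-complete : ∀ x → x ∈ all
  all-complete (v i) = ∈-++⁺ˡ (∈-map⁺ v (∈-allFin i))
  all-complete (u i) = ∈-++⁺ʳ (map v (allFin k)) (∈-map⁺ u (∈-allFin i))

  toℕ-next : ∀ {k} (i : Fin (suc k)) → toℕ (next i) ≡ suc (toℕ i) % suc k
  toℕ-next {k} i = Fin.toℕ-fromℕ< (m%n<n (suc (toℕ i)) (suc k))

  next-≢ : ∀ {k} → 2 ≤ k → (i : Fin k) → i ≢ next i
  next-≢ {suc k} 2≤k i eq with <-cmp (suc (toℕ i)) (suc k)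
  ... | tri< i<k _ _ = 1+n≢n (sym (trans (cong toℕ eq) (trans (toℕ-next i) (m<n⇒m%n≡m i<k))))
  ... | tri> _ _ k<i = <⇒≱ k<i (Fin.toℕ<n i)
  ... | tri≈ _ i≡k _ = <⇒≢ 2≤k (trans (cong suc (sym i≡0)) i≡k)
    where
    i≡0 : toℕ i ≡ 0
    i≡0 = trans (cong toℕ eq) (trans (toℕ-next i)
            (trans (cong (_% suc k) i≡k) (n%n≡0 (suc k))))

  MiddleAdj : MiddleVertex k → MiddleVertex k → Set
  MiddleAdj = SymClosure MiddleEdge

  adj? : ∀ x y → Dec (MiddleAdj x y)
  adj? x y = map′ (λ { (inj₁ e) → fwd e ; (inj₂ e) → bwd e })
                  (λ { (fwd e) → inj₁ e ; (bwd e) → inj₂ e })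
                  (edge? x y ⊎-dec edge? y x)

  loopless : 2 ≤ k → ∀ {x} → ¬ MiddleAdj x x
  loopless 2≤k {v _} (fwd ())
  loopless 2≤k {v _} (bwd ())
  loopless 2≤k {u i} (fwd (u—u⁺ e)) = next-≢ 2≤k i e
  loopless 2≤k {u i} (bwd (u—u⁺ e)) = next-≢ 2≤k i e

  walk-to-u : ∀ m (m<k : m < k) (0<k : 0 < k) →
    Star MiddleAdj (u (fromℕ< 0<k)) (u (fromℕ< m<k))
  walk-to-u zero    _   _   = ε
  walk-to-u (suc m) m<k 0<k =
    walk-to-u m m<k′ 0<k ◅◅ fwd (u—u⁺ (step m<k m<k′)) ◅ ε
    where
    m<k′ : m < k
    m<k′ = <-trans (n<1+n m) m<k
    step : ∀ {k} (m<k : suc m < k) (m<k′ : m < k) → fromℕ< m<k ≡ next (fromℕ< m<k′)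
    step {suc k} m<k m<k′ = Fin.toℕ-injective (trans (Fin.toℕ-fromℕ< m<k) (sym
      (trans (toℕ-next (fromℕ< m<k′))
      (trans (cong (λ j → suc j % suc k) (Fin.toℕ-fromℕ< m<k′)) (m<n⇒m%n≡m m<k)))))

  walk-to : (0<k : 0 < k) → ∀ x → Star MiddleAdj (u (fromℕ< 0<k)) x
  walk-to 0<k (u i) =
    subst (λ j → Star MiddleAdj (u (fromℕ< 0<k)) (u j)) (Fin.fromℕ<-toℕ i (Fin.toℕ<n i))
          (walk-to-u (toℕ i) (Fin.toℕ<n i) 0<k)
  walk-to 0<k (v i) = walk-to 0<k (u i) ◅◅ bwd (v—u refl) ◅ ε

-- The middle graph of the cycle C_k.
M[C_] : (k : ℕ) → 3 ≤ k → Graph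
M[C k ] 3≤k = record
  { V         = MiddleVertex k
  ; _≟_       = _≟ᴹ_
  ; vertices  = all
  ; unique    = all-unique
  ; complete  = all-complete
  ; Adj       = MiddleAdj
  ; adj?      = adj?
  ; symmetric = Sym.symmetric MiddleEdge
  ; loopless  = loopless (<⇒≤ 3≤k)
  ; connected = λ x y → Star.reverse (Sym.symmetric MiddleEdge) (walk-to 0<k x) ◅◅ walk-to 0<k y
  }
  where
  open MiddleCycle k
  0<k : 0 < k
  0<k = ≤-trans (s≤s z≤n) 3≤k

2≤n⇒3≤2n : ∀ {n} → 2 ≤ n → 3 ≤ 2 * n
2≤n⇒3≤2n 2≤n = ≤-trans (n≤1+n 3) (*-monoʳ-≤ 2 2≤n)

M[C₂ₙ] : ∀ n → 2 ≤ n → Graph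
M[C₂ₙ] n 2≤n = M[C 2 * n ] (2≤n⇒3≤2n 2≤n)

{-# OPTIONS --safe #-}
module Submission where

-- Let p pebbles lie on a copy of G, r vertices being odd, and put
-- E = (p + r)/2.  Moving all pairs to an adjacent copy loses E pebbles, and the
-- odd two-pebbling property says that for E > g f(G), g ≥ 1, the copy brings 2g
-- pebbles to the target y of G while E − g f(G) − 1 pairs remain free.  Hence a
-- caterpillar of copies is folded towards its root, level by level: either
-- enough pebbles arrive at y, or the loss is bounded.
--
-- For the target u_i two caterpillars with root u_i cover M(C_2n), and their
-- maximal losses add up to the claimed bound.  For the target v_i the antipode
-- c = v_(i+n) is adjacent to the far ends of both arms.  If E(c) ≤ f(G), its
-- pairs are sent to one arm and both arms are folded.  Otherwise c can also bring
-- a pebble to y at the far end of the heavier arm A.  If A with the pairs of c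
-- does not solve the target, its far end and its last pendant have nearly
-- maximal losses, so they nearly bring the 2^(n−1) pebbles that suffice at y one
-- level down, and what is missing is found in the leftovers, in c, or by
-- sending c to the other arm.
--
-- The case G = K_1 bounds f(M(C_2n)) from above.  For the lower bound put
-- 2^(n+1) − 1 pebbles on v_n and one on every other v_i with i ≠ 0.

open import Defs
open import Data.Empty using (⊥; ⊥-elim)
open import Data.Fin using (Fin; zero; suc; toℕ; fromℕ<)
import Data.Fin.Properties as Fin
open import Data.List using (List; []; _∷_; _++_; map; length; filter; allFin; cartesianProduct; tabulate)
open import Data.List.Membership.Propositional using (_∈_)
open import Data.List.Properties using (length-filter; map-++; map-∘; map-tabulate)
open import Data.List.Relation.Unary.All using ([])
open import Data.List.Relation.Unary.AllPairs using ([]; _∷_)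
open import Data.List.Relation.Unary.Any using (here; there)
open import Data.Nat using (ℕ; zero; suc; _+_; _*_; _∸_; _^_; _/_; _%_; _≤_; _<_; z≤n; s≤s;
  _≤?_; ⌊_/2⌋)
open import Data.Nat.Divisibility using (_∣?_; _∣_; divides; ∣1⇒≡1; ∣m+n∣m⇒∣n)
open import Data.Nat.DivMod using (m≡m%n+[m/n]*n; m%n<n; m<n⇒m%n≡m; n%n≡0; %-distribˡ-+;
  m%n%n≡m%n; [m+n]%n≡m%n)
open import Data.Nat.ListAction using (sum)
open import Data.Nat.ListAction.Properties using (sum-++)
open import Data.Nat.Properties hiding (_≟_)
open import Data.Nat.Tactic.RingSolver using (solve-∀)
open import Data.Product using (∃; ∃₂; _×_; _,_; proj₁; proj₂)
open import Data.Sum using (_⊎_; inj₁; inj₂)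
open import Data.Unit using (⊤; tt)
open import Function using (_∘_; id)
open import Relation.Binary.Construct.Closure.ReflexiveTransitive as Star
  using (Star; ε; _◅_; _◅◅_)
open import Relation.Binary.Construct.Closure.Symmetric using (fwd; bwd)
open import Relation.Binary.Definitions using (tri<; tri≈; tri>)
open import Relation.Binary.PropositionalEquality
open import Relation.Nullary using (¬_; Dec; yes; no; ¬?; contradiction)
open import Relation.Nullary.Decidable using (decidable-stable; map′)

-- An instance of l ≤ r is a certificate for L ≤ R: adding it to L ≤ R leaves
-- a semiring identity.
linear : ∀ {l r L R} c → l ≤ r → L + r + c ≡ R + l → L ≤ R
linear {l} {r} {L} {R} c l≤r eq = +-cancelʳ-≤ r L R (begin
  L + r      ≤⟨ m≤m+n _ c ⟩
  L + r + c  ≡⟨ eq ⟩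
  R + l      ≤⟨ +-monoʳ-≤ R l≤r ⟩
  R + r      ∎)
  where open ≤-Reasoning

-- Plays between distributions, up to surplus pebbles.

infixl 6 _⊕_
_⊕_ : {A : Set} → (A → ℕ) → (A → ℕ) → (A → ℕ)
(X ⊕ Y) x = X x + Y x

∅ : {A : Set} → A → ℕ
∅ _ = 0

infix 4 _⊑_
_⊑_ : {A : Set} → (A → ℕ) → (A → ℕ) → Set
X ⊑ Y = ∀ x → X x ≤ Y x

module Pebbling (Γ : Graph) where
  open Graph Γ

  infix 3 _⟶_
  -- Reaching at least `D′`: discarding the surplus lets plays be composed and framed without
  -- equality of functions.
  record _⟶_ (D D′ : Distribution Γ) : Set where
    constructor reach
    field
      {final} : Distribution Γ
      moves   : Star (Move Γ) D final
      enough  : D′ ⊑ final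

  forget : ∀ {D D′} → D′ ⊑ D → D ⟶ D′
  forget ⊑D = reach ε ⊑D

  -- The surplus `D₁ x ∸ D x` is never touched, so every move stays legal and the surplus is carried
  -- along.
  moves-mono : ∀ {D E D₁} → Star (Move Γ) D E → D ⊑ D₁ → D₁ ⟶ E
  moves-mono ε D⊑ = reach ε D⊑
  moves-mono {D} {_} {D₁} (_◅_ {j = D′} (move {s} {t} a r p o) ms) D⊑
    with reach ns ⊑E ← moves-mono {D₁ = λ x → D′ x + (D₁ x ∸ D x)} ms (λ x → m≤m+n _ _) =
    reach (move a
      (trans (sym (m+[n∸m]≡n (D⊑ s))) (cong (_+ (D₁ s ∸ D s)) r))
      (trans (cong (_+ (D₁ t ∸ D t)) p) (cong suc (m+[n∸m]≡n (D⊑ t))))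
      (λ x x≢s x≢t → trans (cong (_+ (D₁ x ∸ D x)) (o x x≢s x≢t)) (m+[n∸m]≡n (D⊑ x)))
      ◅ ns) ⊑E

  infixr 2 _⨾_
  _⨾_ : ∀ {D D′ D″} → D ⟶ D′ → D′ ⟶ D″ → D ⟶ D″
  reach ms D′⊑ ⨾ reach ms′ D″⊑ with reach ns ⊑E ← moves-mono ms′ D′⊑ =
    reach (ms ◅◅ ns) λ x → ≤-trans (D″⊑ x) (⊑E x)

  frame : ∀ {D D′} F → D ⟶ D′ → D ⊕ F ⟶ D′ ⊕ F
  frame F (reach ms D′⊑) =
    reach (Star.gmap (_⊕ F) framed ms) λ x → +-monoˡ-≤ (F x) (D′⊑ x)
    where
    framed : ∀ {D D′} → Move Γ D D′ → Move Γ (D ⊕ F) (D′ ⊕ F)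
    framed (move {s} {t} a r p o) = move a (cong (_+ F s) r) (cong (_+ F t) p)
      (λ x x≢s x≢t → cong (_+ F x) (o x x≢s x≢t))

  infixl 6 _∥_
  _∥_ : ∀ {D D′ F F′} → D ⟶ D′ → F ⟶ F′ → D ⊕ F ⟶ D′ ⊕ F′
  _∥_ {D} {D′} {F} {F′} d f =
    frame F d ⨾ forget (λ x → ≤-reflexive (+-comm (F x) (D′ x))) ⨾
    frame D′ f ⨾ forget (λ x → ≤-reflexive (+-comm (D′ x) (F′ x)))

  idle : ∀ {D} → D ⟶ D
  idle = forget (λ _ → ≤-refl)

  pt : V → ℕ → Distribution Γ
  pt y k x with y ≟ x
  ... | yes _ = k
  ... | no  _ = 0

  pt-same : ∀ y k → pt y k y ≡ k
  pt-same y k with y ≟ y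
  ... | yes _ = refl
  ... | no y≢y = contradiction refl y≢y

  pt-other : ∀ {y x} k → y ≢ x → pt y k x ≡ 0
  pt-other {y} {x} k y≢x with y ≟ x
  ... | yes y≡x = contradiction y≡x y≢x
  ... | no _ = refl

  pt-+ : ∀ y j k x → pt y (j + k) x ≡ (pt y j ⊕ pt y k) x
  pt-+ y j k x with y ≟ x
  ... | yes _ = refl
  ... | no _ = refl

  pt-0 : ∀ y x → pt y 0 x ≡ 0
  pt-0 y x with y ≟ x
  ... | yes _ = refl
  ... | no _ = refl

  pt-mono : ∀ y {j k} → j ≤ k → pt y j ⊑ pt y k
  pt-mono y j≤k x with y ≟ x
  ... | yes _ = j≤k
  ... | no _ = z≤n

  pt-⊑ : ∀ {y k} {D : Distribution Γ} → k ≤ D y → pt y k ⊑ D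
  pt-⊑ {y} k≤ x with y ≟ x
  ... | yes refl = k≤
  ... | no _ = z≤n

  pt-join : ∀ y j k → pt y j ⊕ pt y k ⟶ pt y (j + k)
  pt-join y j k = forget λ x → ≤-reflexive (pt-+ y j k x)

  canPlace⇒⟶ : ∀ {k y D} → CanPlace Γ k y D → D ⟶ pt y k
  canPlace⇒⟶ (_ , ms , k≤) = reach ms (pt-⊑ k≤)

  ⟶⇒canPlace : ∀ {k y D} → D ⟶ pt y k → CanPlace Γ k y D
  ⟶⇒canPlace {k} {y} (reach {E} ms ⊑E) = E , ms , subst (_≤ E y) (pt-same y k) (⊑E y)

  sum-⊕ : ∀ (X Y : V → ℕ) (xs : List V) → sum (map (X ⊕ Y) xs) ≡ sum (map X xs) + sum (map Y xs)
  sum-⊕ X Y []       = refl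
  sum-⊕ X Y (x ∷ xs) = trans (cong (X x + Y x +_) (sum-⊕ X Y xs))
    (interchange (X x) (Y x) (sum (map X xs)) (sum (map Y xs)))
    where
    interchange : ∀ a b c d → a + b + (c + d) ≡ a + c + (b + d)
    interchange = solve-∀

  size-⊕ : ∀ X Y → size Γ (X ⊕ Y) ≡ size Γ X + size Γ Y
  size-⊕ X Y = sum-⊕ X Y vertices

  sum-∅ : ∀ (xs : List V) → sum (map (∅ {V}) xs) ≡ 0
  sum-∅ []       = refl
  sum-∅ (_ ∷ xs) = sum-∅ xs

  size-∅ : size Γ ∅ ≡ 0
  size-∅ = sum-∅ vertices

  size-pt : ∀ y k → size Γ (pt y k) ≡ k
  size-pt y k = trans
    (Existence.sum-change Γ {D = ∅} vertices unique (complete y)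
      (trans (pt-same y k) (sym (+-identityʳ k))) (λ w w≢y → pt-other k (w≢y ∘ sym)))
    (trans (cong (k +_) size-∅) (+-identityʳ k))

  occupied : ∀ X → 0 < size Γ X → ∃ λ x → 0 < X x
  occupied X = go vertices
    where
    go : ∀ (xs : List V) → 0 < sum (map X xs) → ∃ λ x → 0 < X x
    go (x ∷ xs) 0< with X x in eq
    ... | zero  = go xs 0<
    ... | suc k = x , subst (0 <_) (sym eq) (s≤s z≤n)

  unoccupied : ∀ X → size Γ X ≡ 0 → ∀ x → X x ≡ 0
  unoccupied X eq x = n≤0⇒n≡0 (subst (X x ≤_) eq (Existence.term≤sum Γ {X} (complete x)))

  pick : ∀ X {s} → size Γ X ≡ suc s →
    ∃₂ λ y X′ → (∀ x → X x ≡ (pt y 1 ⊕ X′) x) × size Γ X′ ≡ s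
  pick X {s} eq with y , 0<Xy ← occupied X (subst (0 <_) (sym eq) (s≤s z≤n)) =
    y , X′ , split , suc-injective (begin
      suc (size Γ X′)             ≡⟨ cong (_+ size Γ X′) (size-pt y 1) ⟨
      size Γ (pt y 1) + size Γ X′ ≡⟨ size-⊕ (pt y 1) X′ ⟨
      size Γ (pt y 1 ⊕ X′)        ≡⟨ Existence.size-resp Γ split ⟨
      size Γ X                    ≡⟨ eq ⟩
      suc s                       ∎)
    where
    open ≡-Reasoning
    X′ : Distribution Γ
    X′ x = X x ∸ pt y 1 x
    split : ∀ x → X x ≡ (pt y 1 ⊕ X′) x
    split x = sym (m+[n∸m]≡n (pt-⊑ {D = X} 0<Xy x))

  -- Serves to hand an exact number of pebbles to hypotheses stated for distributions of exact size.
  split-off : ∀ s X → s ≤ size Γ X →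
    ∃₂ λ P Q → (∀ x → X x ≡ (P ⊕ Q) x) × size Γ P ≡ s
  split-off zero    X _ = ∅ , X , (λ _ → refl) , size-∅
  split-off (suc s) X s<
    with y , X′ , eq , size′ ← pick X (sym (m+[n∸m]≡n (≤-trans (s≤s z≤n) s<)))
    with P , Q , eq′ , sizeP ← split-off s X′ (≤-trans (∸-monoˡ-≤ 1 s<) (≤-reflexive (sym size′))) =
    pt y 1 ⊕ P , Q ,
    (λ x → trans (eq x) (trans (cong (pt y 1 x +_) (eq′ x)) (sym (+-assoc (pt y 1 x) (P x) (Q x))))) ,
    trans (size-⊕ (pt y 1) P) (cong₂ _+_ (size-pt y 1) sizeP)

  suffices⇒⟶ : ∀ {p} → Suffices Γ p → ∀ X → p ≤ size Γ X → ∀ y → X ⟶ pt y 1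
  suffices⇒⟶ {p} suff X p≤ y with P , Q , eq , sizeP ← split-off p X p≤ =
    forget (λ x → ≤-trans (m≤m+n (P x) (Q x)) (≤-reflexive (sym (eq x)))) ⨾
    canPlace⇒⟶ (suff P sizeP y)

  suffices-mono : ∀ {p q} → p ≤ q → Suffices Γ p → Suffices Γ q
  suffices-mono p≤q suff D eq y =
    ⟶⇒canPlace (suffices⇒⟶ suff D (≤-trans p≤q (≤-reflexive (sym eq))) y)

  sum-except : (y : V) (D : Distribution Γ) → D y ≡ 0 → (∀ x → x ≢ y → D x ≡ 1) →
    suc (size Γ D) ≡ length vertices
  sum-except y D Dy Dx = trans
    (sym (Existence.sum-change Γ {D = D} {E = λ _ → 1} {c = 1} vertices unique (complete y)
      (cong suc (sym Dy)) (λ x x≢y → sym (Dx x x≢y))))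
    (ones vertices)
    where
    ones : ∀ (xs : List V) → sum (map (λ _ → 1) xs) ≡ length xs
    ones []       = refl
    ones (_ ∷ xs) = cong suc (ones xs)

  -- One pebble on every vertex but the target admits no move.
  order≤ : ∀ {p} → Suffices Γ p → V → length vertices ≤ p
  order≤ {p} suff y with length vertices ≤? p
  ... | yes ≤p = ≤p
  ... | no ≰p = ⊥-elim (stuck (suffices-mono (≤-pred (subst (suc p ≤_) (sym size-D) (≰⇒> ≰p))) suff D refl y))
    where
    D : Distribution Γ
    D x = 1 ∸ pt y 1 x
    D≤1 : ∀ x → D x ≤ 1
    D≤1 x = m∸n≤m 1 (pt y 1 x)
    Dy : D y ≡ 0
    Dy = cong (1 ∸_) (pt-same y 1)
    size-D : suc (size Γ D) ≡ length vertices
    size-D = sum-except y D Dy (λ x x≢y → cong (1 ∸_) (pt-other 1 (x≢y ∘ sym)))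
    stuck : ¬ CanPlace Γ 1 y D
    stuck (_ , ε , 1≤) = 1+n≰n (subst (1 ≤_) Dy 1≤)
    stuck (_ , m ◅ _ , _) = 1+n≰n (≤-trans (Existence.move-source Γ m) (D≤1 _))

-- A single copy of G under the odd two-pebbling property.

weight≤count : {A : Set} {P : A → Set} (P? : ∀ x → Dec (P x)) (O : A → ℕ) →
  (∀ x → O x ≤ 1) → (∀ x → O x ≡ 1 → P x) →
  ∀ xs → sum (map O xs) ≤ length (filter P? xs)
weight≤count P? O O≤1 O⇒P [] = z≤n
weight≤count P? O O≤1 O⇒P (x ∷ xs) with P? x | weight≤count P? O O≤1 O⇒P xs
... | yes _ | rest = +-mono-≤ (O≤1 x) rest
... | no ¬P | rest = +-mono-≤ (≤-pred (≤∧≢⇒< (O≤1 x) (¬P ∘ O⇒P x))) rest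

double : {A : Set} → (A → ℕ) → (A → ℕ)
double X = X ⊕ X

-- `F` is any sufficient number for which the odd two-pebbling property holds, so that both `f G`
-- and the value 1 for K_1 can be inserted.
module Fibre (G : Graph) (F : ℕ) (suffices : Suffices G F)
  (oddTwo : ∀ D → 2 * F < size G D + oddCount G D → ∀ y → CanPlace G 2 y D)
  (y : Graph.V G) where

  open Graph G
  open Pebbling G

  many : ∀ g X → g * F ≤ size G X → X ⟶ pt y g
  many zero    X _ = forget (pt-⊑ z≤n)
  many (suc g) X ≤X with P , Q , eq , sizeP ← split-off F X (≤-trans (m≤m+n F (g * F)) ≤X) =
    forget (λ x → ≤-reflexive (sym (eq x))) ⨾
    suffices⇒⟶ suffices P (≤-reflexive (sym sizeP)) y ∥ many g Q gF≤ ⨾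
    pt-join y 1 g
    where
    gF≤ : g * F ≤ size G Q
    gF≤ = +-cancelˡ-≤ F (g * F) (size G Q) (≤-trans ≤X (≤-reflexive
      (trans (Existence.size-resp G eq) (trans (size-⊕ P Q) (cong (_+ size G Q) sizeP)))))

  half parity : Distribution G → Distribution G
  half X x = X x / 2
  parity X x = X x % 2

  -- The number of pebbles lost when all pairs of X are moved to an adjacent
  -- copy; half of p + r in the odd two-pebbling property.
  loss : Distribution G → ℕ
  loss X = size G (half X) + size G (parity X)

  halves : ∀ X x → X x ≡ (double (half X) ⊕ parity X) x
  halves X x = trans (m≡m%n+[m/n]*n (X x) 2) (twice (X x % 2) (X x / 2))
    where
    twice : ∀ a b → a + b * 2 ≡ b + b + a
    twice = solve-∀

  size-double : ∀ X → size G (double X) ≡ size G X + size G X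
  size-double X = size-⊕ X X

  size-half+loss : ∀ X → size G X ≡ size G (half X) + loss X
  size-half+loss X = trans (Existence.size-resp G (halves X))
    (trans (size-⊕ (double (half X)) (parity X))
    (trans (cong (_+ size G (parity X)) (size-double (half X)))
    (+-assoc (size G (half X)) (size G (half X)) (size G (parity X)))))

  parity≤1 : ∀ X x → parity X x ≤ 1
  parity≤1 X x = ≤-pred (m%n<n (X x) 2)

  size≤order : ∀ O → (∀ x → O x ≤ 1) → size G O ≤ length vertices
  size≤order O O≤1 = go vertices
    where
    go : ∀ (xs : List V) → sum (map O xs) ≤ length xs
    go []       = z≤n
    go (x ∷ xs) = +-mono-≤ (O≤1 x) (go xs)

  size≤oddCount : ∀ P O → (∀ x → O x ≤ 1) → size G O ≤ oddCount G (double P ⊕ O)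
  size≤oddCount P O O≤1 = weight≤count (λ x → ¬? (2 ∣? D x)) O O≤1 isOdd vertices
    where
    D : Distribution G
    D = double P ⊕ O
    2∣double : ∀ x → 2 ∣ P x + P x
    2∣double x = divides (P x) (trans (cong (P x +_) (sym (+-identityʳ (P x)))) (*-comm 2 (P x)))
    isOdd : ∀ x → O x ≡ 1 → ¬ 2 ∣ D x
    isOdd x Ox 2∣ with () ← ∣1⇒≡1 (subst (2 ∣_) Ox (∣m+n∣m⇒∣n 2∣ (2∣double x)))

  parity≤F : ∀ X → size G (parity X) ≤ F
  parity≤F X = ≤-trans (size≤order (parity X) (parity≤1 X)) (order≤ suffices y)

  -- No truncation occurs, since the number of odd vertices is at most |V(G)| ≤ F.
  complement : ∀ X {p} → p ≡ suc F ∸ size G (parity X) → p + size G (parity X) ≡ suc F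
  complement X refl = m∸n+n≡m (m≤n⇒m≤1+n (parity≤F X))

  -- Here p counts the pairs reserved for the o odd pebbles; the remaining r pairs still have to
  -- bring g pebbles to y.
  room : ∀ {h p r o} gF → h ≡ p + r → p + o ≡ suc F → F + gF < h + o → gF ≤ r
  room {h} {p} {r} {o} gF eq po lt = +-cancelˡ-≤ (suc F) gF r (≤-trans lt (≤-reflexive
    (trans (cong (_+ o) eq) (trans (exchange p r o) (cong (_+ r) po)))))
    where
    exchange : ∀ p r o → p + r + o ≡ p + o + r
    exchange = solve-∀

  -- The odd pebbles of X are only useful together with enough of its pairs:
  -- exactly F + 1 − r of them.
  gather : ∀ g X → suc g * F < loss X →
    ∃ λ Q → (X ⟶ double (pt y (suc g)) ⊕ double Q) × loss X ≤ size G Q + suc g * F + 1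
  gather g X lt
    with P , R , H≡ , sizeP ← split-off (suc F ∸ size G (parity X)) (half X)
           (≤-trans (∸-monoˡ-≤ (size G (parity X)) (≤-trans (s≤s (m≤m+n F (g * F))) lt))
                    (≤-reflexive (m+n∸n≡m (size G (half X)) (size G (parity X)))))
    with R₁ , Q , R≡ , sizeR₁ ← split-off (g * F) R
           (room (g * F)
             (trans (Existence.size-resp G H≡) (size-⊕ P R))
             (complement X sizeP) lt) =
    Q ,
    (forget (λ x → ≤-reflexive (sym (parts x))) ⨾
     odd-part ∥ ((even-part ∥ even-part) ∥ idle) ⨾
     forget (λ x → ≤-reflexive (collect x))) ,
    ≤-reflexive (total (size G P) (size G R) (size G (parity X)) (g * F)
      (trans (Existence.size-resp G H≡) (size-⊕ P R))
      (complement X sizeP)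
      (trans (Existence.size-resp G R≡) (trans (size-⊕ R₁ Q) (cong (_+ size G Q) sizeR₁))))
    where
    O : Distribution G
    O = parity X
    total : ∀ p r o gF {q} → size G (half X) ≡ p + r → p + o ≡ suc F → r ≡ gF + q →
      size G (half X) + o ≡ q + (F + gF) + 1
    total p r o gF {q} eq po refl = trans (cong (_+ o) eq)
      (trans (shuffle p gF q o) (trans (cong (_+ (gF + q)) po) (finish F gF q)))
      where
      shuffle : ∀ p gF q o → p + (gF + q) + o ≡ p + o + (gF + q)
      shuffle = solve-∀
      finish : ∀ F gF q → suc F + (gF + q) ≡ q + (F + gF) + 1
      finish = solve-∀
    -- With p pairs and o odd pebbles, pebbles plus odd vertices number at least 2 p + 2 o = 2 F +
    -- 2, which is above the threshold 2 F.
    odd-part : double P ⊕ O ⟶ pt y 2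
    odd-part = canPlace⇒⟶ (oddTwo (double P ⊕ O) (≤-trans
      enough (+-monoʳ-≤ (size G (double P ⊕ O)) (size≤oddCount P O (parity≤1 X)))) y)
      where
      p o : ℕ
      p = size G P
      o = size G O
      twice : ∀ p o → 2 * (p + o) ≡ p + p + o + o
      twice = solve-∀
      enough : suc (2 * F) ≤ size G (double P ⊕ O) + size G O
      enough = begin
        suc (2 * F)                    <⟨ ≤-reflexive (sym (*-suc 2 F)) ⟩
        2 * suc F                      ≡⟨ cong (2 *_) p+o ⟨
        2 * (p + o)                    ≡⟨ twice p o ⟩
        p + p + o + o                  ≡⟨ cong (λ s → s + o + o) (size-double P) ⟨
        size G (double P) + o + o      ≡⟨ cong (_+ o) (size-⊕ (double P) O) ⟨
        size G (double P ⊕ O) + o      ∎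
        where
        open ≤-Reasoning
        p+o : p + o ≡ suc F
        p+o = complement X sizeP
    -- `R₁` counts g F pairs. Each of the two halves of these pairs brings g pebbles to y, so that
    -- with `odd-part` there are 2 g + 2.
    even-part : R₁ ⟶ pt y g
    even-part = many g R₁ (≤-reflexive (sym sizeR₁))
    parts : ∀ x → X x ≡ ((double P ⊕ O) ⊕ (double R₁ ⊕ double Q)) x
    parts x = trans (halves X x)
      (trans (cong (λ h → h + h + O x) (trans (H≡ x) (cong (P x +_) (R≡ x))))
             (regroup (P x) (R₁ x) (Q x) (O x)))
      where
      regroup : ∀ p r q o → p + (r + q) + (p + (r + q)) + o ≡ p + p + o + (r + r + (q + q))
      regroup = solve-∀
    collect : ∀ x → (double (pt y (suc g)) ⊕ double Q) x ≡
      (pt y 2 ⊕ (double (pt y g) ⊕ double Q)) x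
    collect x = trans (cong (λ h → h + h + (Q x + Q x)) (pt-+ y 1 g x))
      (trans (regroup (pt y 1 x) (pt y g x) (Q x)) (cong (_+ (double (pt y g) ⊕ double Q) x) (sym (pt-+ y 1 1 x))))
      where
      regroup : ∀ a b q → a + b + (a + b) + (q + q) ≡ a + a + (b + b + (q + q))
      regroup = solve-∀

-- Plays on the copies of G in a product.

module SingleMove (Γ : Graph) where
  open Graph Γ
  open Pebbling Γ

  pt-move : ∀ {s t} → Adj s t → pt s 2 ⟶ pt t 1
  pt-move {s} {t} a = reach (move a
    (trans (pt-same s 2) (cong (2 +_) (sym (pt-other 1 (s≢t ∘ sym)))))
    (trans (pt-same t 1) (cong suc (sym (pt-other 2 s≢t))))
    (λ x x≢s x≢t → trans (pt-other 1 (x≢t ∘ sym)) (sym (pt-other 2 (x≢s ∘ sym))))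
    ◅ ε) λ _ → ≤-refl
    where
    s≢t : s ≢ t
    s≢t = Existence.adj⇒≢ Γ a

-- A caterpillar with root `path 0`. The indices are unbounded because an arm may wind around the
-- cycle; only an initial segment ever carries pebbles.
record Arm (K : Graph) : Set where
  open Graph K
  field
    path pendant    : ℕ → V
    path-adj        : ∀ j → Adj (path (suc j)) (path j)
    pendant-adj     : ∀ j → Adj (pendant j) (path j)
    pendant-adj⁺    : ∀ j → Adj (pendant j) (path (suc j))

module Columns (K G : Graph) (F : ℕ) (suffices : Suffices G F)
  (oddTwo : ∀ D → 2 * F < size G D + oddCount G D → ∀ y → CanPlace G 2 y D)
  (y : Graph.V G) where

  private
    module K = Graph K
    module G = Graph G
    module PG = Pebbling G

  open PG using (pt; pt-+; pt-join)
  open Fibre G F suffices oddTwo y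
  open Pebbling (K □ G) using (_⟶_; reach; forget) renaming (_⨾_ to _⨟_; _∥_ to _∣∣_)

  column : K.V → Distribution G → Distribution (K □ G)
  column a X (b , x) with a K.≟ b
  ... | yes _ = X x
  ... | no  _ = 0

  column-same : ∀ a X x → column a X (a , x) ≡ X x
  column-same a X x with a K.≟ a
  ... | yes _ = refl
  ... | no a≢a = contradiction refl a≢a

  column-other : ∀ {a b} X x → a ≢ b → column a X (b , x) ≡ 0
  column-other {a} {b} X x a≢b with a K.≟ b
  ... | yes a≡b = contradiction a≡b a≢b
  ... | no _ = refl

  column-∅ : ∀ a z → column a ∅ z ≡ 0
  column-∅ a (b , x) with a K.≟ b
  ... | yes _ = refl
  ... | no _ = refl

  column-mono : ∀ a {X Y} → X ⊑ Y → column a X ⊑ column a Y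
  column-mono a X⊑Y (b , x) with a K.≟ b
  ... | yes _ = X⊑Y x
  ... | no _ = z≤n

  column-⊕ : ∀ a X Y z → column a (X ⊕ Y) z ≡ (column a X ⊕ column a Y) z
  column-⊕ a X Y (b , x) with a K.≟ b
  ... | yes _ = refl
  ... | no _ = refl

  column-merge : ∀ a X Y → column a X ⊕ column a Y ⟶ column a (X ⊕ Y)
  column-merge a X Y = forget λ z → ≤-reflexive (column-⊕ a X Y z)

  column-unmerge : ∀ a X Y → column a (X ⊕ Y) ⟶ column a X ⊕ column a Y
  column-unmerge a X Y = forget λ z → ≤-reflexive (sym (column-⊕ a X Y z))

  column-lift : ∀ a {X Y} → X PG.⟶ Y → column a X ⟶ column a Y
  column-lift a (PG.reach ms Y⊑E) = reach (Star.gmap (column a) lifted ms) (column-mono a Y⊑E)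
    where
    lifted : ∀ {D D′} → Move G D D′ → Move (K □ G) (column a D) (column a D′)
    lifted {D} {D′} (move {s} {t} e r p o) = move (inj₂ (refl , e))
      (trans (column-same a D s) (trans r (cong (2 +_) (sym (column-same a D′ s)))))
      (trans (column-same a D′ t) (trans p (cong suc (sym (column-same a D t)))))
      other
      where
      other : ∀ z → z ≢ (a , s) → z ≢ (a , t) → column a D′ z ≡ column a D z
      other (b , x) ≢s ≢t with a K.≟ b
      ... | yes refl = o x (λ { refl → ≢s refl }) (λ { refl → ≢t refl })
      ... | no _ = refl

  column-pt : ∀ a x k z → column a (pt x k) z ≡ Pebbling.pt (K □ G) (a , x) k z
  column-pt a x k (b , w) with a K.≟ b
  ... | no _ = refl
  ... | yes refl with x G.≟ w
  ...   | yes refl = refl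
  ...   | no _ = refl

  -- The pairs cross one at a time, by induction on the size of `Y`.
  column-cross : ∀ {a b} → K.Adj a b → ∀ Y → column a (double Y) ⟶ column b Y
  column-cross {a} {b} e Y = go (size G Y) Y refl
    where
    unit : ∀ x → column a (double (pt x 1)) ⟶ column b (pt x 1)
    unit x =
      forget (λ z → ≤-trans (≤-reflexive (sym (column-pt a x 2 z)))
        (column-mono a (λ w → ≤-reflexive (pt-+ x 1 1 w)) z)) ⨟
      SingleMove.pt-move (K □ G) (inj₁ (e , refl)) ⨟
      forget (λ z → ≤-reflexive (column-pt b x 1 z))
    swap-pairs : ∀ p q → p + q + (p + q) ≡ p + p + (q + q)
    swap-pairs = solve-∀
    go : ∀ n Y → size G Y ≡ n → column a (double Y) ⟶ column b Y
    go zero Y eq = forget nothing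
      where
      nothing : column b Y ⊑ column a (double Y)
      nothing (c , x) with b K.≟ c
      ... | yes _ = subst (_≤ column a (double Y) (c , x)) (sym (PG.unoccupied Y eq x)) z≤n
      ... | no _ = z≤n
    go (suc n) Y eq with x , Y′ , Y≡ , size′ ← PG.pick Y eq =
      column-lift a (PG.forget λ w → ≤-reflexive (sym (trans
        (cong (λ k → k + k) (Y≡ w)) (swap-pairs (pt x 1 w) (Y′ w))))) ⨟
      column-unmerge a (double (pt x 1)) (double Y′) ⨟
      unit x ∣∣ go n Y′ size′ ⨟
      column-merge b (pt x 1) Y′ ⨟
      column-lift b (PG.forget λ w → ≤-reflexive (Y≡ w))

  infixl 6 _∙_
  -- Formal sums of loaded copies. Unlike functions, these terms can be unified, so that rearranging
  -- them needs no explicit arguments.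
  data Config : Set where
    col : K.V → Distribution G → Config
    _∙_ : Config → Config → Config

  ⟦_⟧ : Config → Distribution (K □ G)
  ⟦ col a X ⟧ = column a X
  ⟦ s ∙ t ⟧   = ⟦ s ⟧ ⊕ ⟦ t ⟧

  infix 3 _⇒_
  record _⇒_ (s t : Config) : Set where
    constructor run
    field
      play : ⟦ s ⟧ ⟶ ⟦ t ⟧

  infixr 2 _⨾_
  _⨾_ : ∀ {s t r} → s ⇒ t → t ⇒ r → s ⇒ r
  run p ⨾ run q = run (p ⨟ q)

  infixl 6 _∥_
  _∥_ : ∀ {s s′ t t′} → s ⇒ s′ → t ⇒ t′ → s ∙ t ⇒ s′ ∙ t′
  run p ∥ run q = run (p ∣∣ q)

  idle : ∀ {s} → s ⇒ s
  idle = run (forget λ _ → ≤-refl)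

  assocˡ : ∀ {s t r} → s ∙ (t ∙ r) ⇒ s ∙ t ∙ r
  assocˡ {s} {t} {r} = run (forget λ z → ≤-reflexive (+-assoc (⟦ s ⟧ z) (⟦ t ⟧ z) (⟦ r ⟧ z)))

  assocʳ : ∀ {s t r} → s ∙ t ∙ r ⇒ s ∙ (t ∙ r)
  assocʳ {s} {t} {r} = run (forget λ z → ≤-reflexive (sym (+-assoc (⟦ s ⟧ z) (⟦ t ⟧ z) (⟦ r ⟧ z))))

  swap : ∀ {s t} → s ∙ t ⇒ t ∙ s
  swap {s} {t} = run (forget λ z → ≤-reflexive (+-comm (⟦ t ⟧ z) (⟦ s ⟧ z)))

  keepˡ : ∀ {s t} → s ∙ t ⇒ s
  keepˡ {s} {t} = run (forget λ z → m≤m+n (⟦ s ⟧ z) (⟦ t ⟧ z))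

  keepʳ : ∀ {s t} → s ∙ t ⇒ t
  keepʳ = swap ⨾ keepˡ

  merge : ∀ {a X Y} → col a X ∙ col a Y ⇒ col a (X ⊕ Y)
  merge {a} {X} {Y} = run (column-merge a X Y)

  unmerge : ∀ {a X Y} → col a (X ⊕ Y) ⇒ col a X ∙ col a Y
  unmerge {a} {X} {Y} = run (column-unmerge a X Y)

  lift : ∀ {a X Y} → X PG.⟶ Y → col a X ⇒ col a Y
  lift {a} p = run (column-lift a p)

  cross : ∀ {a b Y} → K.Adj a b → col a (double Y) ⇒ col b Y
  cross {Y = Y} e = run (column-cross e Y)

  -- Odd pebbles are abandoned; by `size-half+loss` exactly `loss X` pebbles disappear.
  push : ∀ {a b} → K.Adj a b → ∀ X → col a X ⇒ col b (half X)
  push {a} e X = lift (PG.forget λ w →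
    ≤-trans (m≤m+n _ (parity X w)) (≤-reflexive (sym (halves X w)))) ⨾ cross e

  many-at : ∀ a g X → g * F ≤ size G X → col a X ⇒ col a (pt y g)
  many-at a g X gF≤ = lift (many g X gF≤)

  gather-at : ∀ a g X → suc g * F < loss X →
    ∃ λ Q → (col a X ⇒ col a (double (pt y (suc g))) ∙ col a (double Q)) ×
            loss X ≤ size G Q + suc g * F + 1
  gather-at a g X lt =
    let Q , r , bound = gather g X lt in
    Q , (lift r ⨾ unmerge) , bound

  gather-across : ∀ {a b} → K.Adj a b → ∀ g X → suc g * F < loss X →
    ∃ λ Q → (col a X ⇒ col b (pt y (suc g)) ∙ col b Q) × loss X ≤ size G Q + suc g * F + 1
  gather-across {a} e g X lt =
    let Q , r , bound = gather-at a g X lt in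
    Q , (r ⨾ cross e ∥ cross e) , bound

  0<F : 0 < F
  0<F = ≤-trans (nonempty (G.complete y)) (PG.order≤ suffices y)
    where
    nonempty : ∀ {xs} → y ∈ xs → 0 < length xs
    nonempty (here _)  = s≤s z≤n
    nonempty (there _) = s≤s z≤n

  m≤m*F : ∀ m → m ≤ m * F
  m≤m*F m = ≤-trans (≤-reflexive (sym (*-identityʳ m))) (*-monoʳ-≤ m 0<F)

  -- Apart from E = 0, h is the quotient E / F rounded up, minus one. It is found as a least number,
  -- which exists because F ≥ 1.
  quotient : ∀ E → ∃ λ h → E ≤ suc h * F × (h ≡ 0 ⊎ h * F < E)
  quotient E with Existence.least G (λ h → E ≤? suc h * F) E
                    (≤-trans (n≤1+n E) (m≤m*F (suc E)))
  ... | zero  , E≤ , _   = 0 , E≤ , inj₁ refl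
  ... | suc h , E≤ , min = suc h , E≤ , inj₂ (≰⇒> λ E≤′ → 1+n≰n (min h E≤′))

  col-pt-0 : ∀ b X → X ⇒ col b (pt y 0)
  col-pt-0 b X = run (forget λ z → ≤-trans
    (≤-reflexive (trans (column-pt b y 0 z) (Pebbling.pt-0 (K □ G) (b , y) z))) z≤n)

  -- For h ≥ 1 the quotient satisfies h F < `loss X`, which is what `gather-across` asks for; for h
  -- = 0 nothing has to be delivered.
  send : ∀ {a b} → K.Adj a b → ∀ X →
    ∃ λ h → (col a X ⇒ col b (pt y h)) × loss X ≤ suc h * F
  send {a} {b} e X = let h , ≤F , h≡0⊎lt = quotient (loss X) in h , deliver h h≡0⊎lt , ≤F
    where
    deliver : ∀ h → h ≡ 0 ⊎ h * F < loss X → col a X ⇒ col b (pt y h)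
    deliver zero    _         = col-pt-0 b (col a X)
    deliver (suc h) (inj₂ lt) = let Q , r , _ = gather-across e h X lt in
      r ⨾ keepˡ

  -- Folding a caterpillar of copies towards its root.

  module _ (A : Arm K) where
    open Arm A

    descend : ∀ g j → col (path j) (pt y (g * 2 ^ j)) ⇒ col (path 0) (pt y g)
    descend g zero    = lift (PG.forget λ w → ≤-reflexive (cong (λ k → pt y k w) (sym (*-identityʳ g))))
    descend g (suc j) =
      lift (PG.forget λ w → ≤-reflexive (trans (sym (pt-+ y (g * 2 ^ j) (g * 2 ^ j) w))
        (cong (λ k → pt y k w) (twice g (2 ^ j))))) ⨾
      cross (path-adj j) ⨾ descend g j
      where
      twice : ∀ g p → g * p + g * p ≡ g * (2 * p)
      twice = solve-∀

  -- The greatest loss, in units of F, in folding j levels that fail to bring g pebbles to y at the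
  -- root; the level folded onto `path j` contributes g 2ʲ + 1.
  cost : ℕ → ℕ → ℕ
  cost g zero    = 0
  cost g (suc j) = suc (g * 2 ^ j) + cost g j

  -- The closed form g (2ʲ - 1) + j, written without subtraction.
  cost-closed : ∀ g j → cost g j + g ≡ g * 2 ^ j + j
  cost-closed g zero    = sym (trans (+-identityʳ _) (*-identityʳ g))
  cost-closed g (suc j) = trans (step (g * 2 ^ j) (cost g j) g)
    (trans (cong (λ k → suc (g * 2 ^ j) + k) (cost-closed g j)) (finish g (2 ^ j) j))
    where
    step : ∀ p c g → suc p + c + g ≡ suc p + (c + g)
    step = solve-∀
    finish : ∀ g p j → suc (g * p) + (g * p + j) ≡ g * (2 * p) + suc j
    finish = solve-∀

  cost-1-2 : ∀ j → cost 1 j + 2 ^ j ≡ cost 2 j + 1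
  cost-1-2 zero    = refl
  cost-1-2 (suc j) = trans (step (2 ^ j) (cost 1 j))
    (trans (cong (suc (2 * 2 ^ j) +_) (cost-1-2 j)) (sym (+-assoc (suc (2 * 2 ^ j)) (cost 2 j) 1)))
    where
    step : ∀ p c → suc (1 * p) + c + 2 * p ≡ suc (2 * p) + (c + p)
    step = solve-∀

  module Load (A : Arm K) (X W : ℕ → Distribution G) where
    open Arm A

    -- The load `Z` of the far end is a parameter because folding a level adds to it; the loads
    -- below it are still those of `X` and `W`.
    caterpillar : ℕ → Distribution G → Config
    caterpillar zero    Z = col (path 0) Z
    caterpillar (suc j) Z = col (path (suc j)) Z ∙ (col (pendant j) (W j) ∙ caterpillar j (X j))

    weight : ℕ → Distribution G → ℕ
    weight zero    Z = size G Z
    weight (suc j) Z = size G Z + (size G (W j) + weight j (X j))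

    weight-⊕ : ∀ j Y Z → weight j (Y ⊕ Z) ≡ weight j Y + size G Z
    weight-⊕ zero    Y Z = PG.size-⊕ Y Z
    weight-⊕ (suc j) Y Z = trans (cong (_+ (size G (W j) + weight j (X j))) (PG.size-⊕ Y Z))
      (exchange (size G Y) (size G Z) (size G (W j) + weight j (X j)))
      where
      exchange : ∀ a b c → a + b + c ≡ a + c + b
      exchange = solve-∀

    add-top : ∀ j Y Z → col (path j) Y ∙ caterpillar j Z ⇒ caterpillar j (Z ⊕ Y)
    add-top zero    Y Z = swap ⨾ merge
    add-top (suc j) Y Z = assocˡ ⨾ (swap ⨾ merge) ∥ idle

    fold-level : ∀ j Z → caterpillar (suc j) Z ⇒ caterpillar j (X j ⊕ half (W j) ⊕ half Z)
    fold-level j Z =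
      push (path-adj j) Z ∥ (push (pendant-adj j) (W j) ∥ idle ⨾ add-top j (half (W j)) (X j)) ⨾
      add-top j (half Z) (X j ⊕ half (W j))

    weight-fold : ∀ j Z →
      weight (suc j) Z ≡ weight j (X j ⊕ half (W j) ⊕ half Z) + (loss Z + loss (W j))
    weight-fold j Z = begin
      size G Z + (size G (W j) + weight j (X j))
        ≡⟨ cong₂ (λ a b → a + (b + weight j (X j))) (size-half+loss Z) (size-half+loss (W j)) ⟩
      (hZ + loss Z) + ((hW + loss (W j)) + weight j (X j))
        ≡⟨ regroup hZ (loss Z) hW (loss (W j)) (weight j (X j)) ⟩
      (weight j (X j) + hW + hZ) + (loss Z + loss (W j))
        ≡⟨ cong (λ k → k + hZ + (loss Z + loss (W j))) (weight-⊕ j (X j) (half (W j))) ⟨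
      weight j (X j ⊕ half (W j)) + hZ + (loss Z + loss (W j))
        ≡⟨ cong (_+ (loss Z + loss (W j))) (weight-⊕ j (X j ⊕ half (W j)) (half Z)) ⟨
      weight j (X j ⊕ half (W j) ⊕ half Z) + (loss Z + loss (W j)) ∎
      where
      open ≡-Reasoning
      hZ hW : ℕ
      hZ = size G (half Z)
      hW = size G (half (W j))
      regroup : ∀ a b c d e → (a + b) + ((c + d) + e) ≡ (e + c + a) + (b + d)
      regroup = solve-∀

    Collapses : ℕ → ℕ → Distribution G → Set
    Collapses g j Z = (caterpillar j Z ⇒ col (path 0) (pt y g)) ⊎
      ∃ λ Q → (caterpillar j Z ⇒ col (path 0) Q) × weight j Z ≤ size G Q + cost g j * F

    -- If the far end and its pendant can jointly send g 2ʲ pebbles to y one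
    -- level down, these suffice; otherwise, with at most h and h′ of them, their
    -- losses are at most (h + 1) F and (h′ + 1) F, in total (g 2ʲ + 1) F.
    collapse : ∀ g j Z → Collapses g j Z
    collapse g zero    Z = inj₂ (Z , idle , ≤-reflexive (sym (+-identityʳ _)))
    collapse g (suc j) Z =
      let h  , sendZ , lossZ = send (path-adj j) Z
          h′ , sendW , lossW = send (pendant-adj j) (W j)
      in level h h′ sendZ lossZ sendW lossW (g * 2 ^ j ≤? h + h′)
      where
      level : ∀ h h′ → col (path (suc j)) Z ⇒ col (path j) (pt y h) → loss Z ≤ suc h * F →
        col (pendant j) (W j) ⇒ col (path j) (pt y h′) → loss (W j) ≤ suc h′ * F →
        Dec (g * 2 ^ j ≤ h + h′) → Collapses g (suc j) Z
      level h h′ sendZ lossZ sendW lossW (yes enough) = inj₁ (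
        sendZ ∥ (sendW ∥ idle) ⨾ assocˡ ⨾ keepˡ ⨾ merge ⨾
        lift (pt-join y h h′ PG.⨾ PG.forget (PG.pt-mono y enough)) ⨾
        descend A g j)
      level h h′ sendZ lossZ sendW lossW (no few) with collapse g j (X j ⊕ half (W j) ⊕ half Z)
      ... | inj₁ done = inj₁ (fold-level j Z ⨾ done)
      ... | inj₂ (Q , r , bound) = inj₂ (Q , (fold-level j Z ⨾ r) , account)
        where
        account : weight (suc j) Z ≤ size G Q + cost g (suc j) * F
        account = begin
          weight (suc j) Z
            ≡⟨ weight-fold j Z ⟩
          weight j (X j ⊕ half (W j) ⊕ half Z) + (loss Z + loss (W j))
            ≤⟨ +-mono-≤ bound (+-mono-≤ lossZ lossW) ⟩
          (size G Q + cost g j * F) + (suc h * F + suc h′ * F)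
            ≡⟨ collect (size G Q) (cost g j) h h′ F ⟩
          size G Q + (cost g j + suc (suc (h + h′))) * F
            ≤⟨ +-monoʳ-≤ (size G Q) (*-monoˡ-≤ F (+-monoʳ-≤ (cost g j) (s≤s (≰⇒> few)))) ⟩
          size G Q + (cost g j + suc (g * 2 ^ j)) * F
            ≡⟨ cong (λ k → size G Q + k * F) (+-comm (cost g j) (suc (g * 2 ^ j))) ⟩
          size G Q + cost g (suc j) * F ∎
          where
          open ≤-Reasoning
          collect : ∀ s c h k F → (s + c * F) + ((1 + h) * F + (1 + k) * F) ≡ s + (c + (2 + (h + k))) * F
          collect = solve-∀

-- The inequalities behind the vertex target.

-- The weights of VertexTarget: p₀ at the target, e and E the pairs and the loss
-- of the antipode, SA and SB the two arms, pm, W = hW + EW and R the far end,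
-- the last pendant and the rest of the first arm, q = 2ᵐ and C = cost 2 m.
module Arithmetic where

  -- Here c is `cost 2 (suc m)`. The arms lose at most 2 (c + 1) F and the antipode at most F,
  -- together (2 c + 3) F, so F pebbles are left at the target.
  bothArms : ∀ p₀ e E SA SB Y₁ Y₂ c F →
    2 * ((c + 2) * F) ≤ p₀ + ((e + E) + (SA + SB)) → E ≤ F →
    p₀ + (SA + e) ≤ Y₁ + (c + 1) * F → Y₁ + SB ≤ Y₂ + (c + 1) * F → ¬ suc Y₂ ≤ F
  bothArms p₀ e E SA SB Y₁ Y₂ c F T E≤F a b Y₂< =
    contradiction (linear {R = 0} 0 (+-mono-≤ T (+-mono-≤ E≤F (+-mono-≤ a (+-mono-≤ b Y₂<))))
      (eq p₀ e E SA SB Y₁ Y₂ c F)) (1+n≰n {0})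
    where
    eq : ∀ p₀ e E SA SB Y₁ Y₂ c F →
      1 + (p₀ + ((e + E) + (SA + SB)) + (F + (Y₁ + (c + 1) * F + (Y₂ + (c + 1) * F + F)))) + 0 ≡
      0 + (2 * ((c + 2) * F) + (E + (p₀ + (SA + e) + (Y₁ + SB + (1 + Y₂)))))
    eq = solve-∀

  -- Y remains at the target after the other arm, joined by the pairs of the antipode, is folded. As
  -- Y < F, fewer than (c + 2) F pebbles took part, and the first arm and the antipode hold the
  -- rest.
  deficit : ∀ p₀ e r SA SB Y c F →
    2 * ((c + 2) * F) ≤ p₀ + ((e + (e + r)) + (SA + SB)) → r ≤ F →
    p₀ + (SB + e) ≤ Y + (c + 1) * F → suc Y ≤ F → (c + 2) * F + 1 ≤ SA + e + F
  deficit p₀ e r SA SB Y c F T r≤F b Y< =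
    linear 0 (+-mono-≤ T (+-mono-≤ r≤F (+-mono-≤ b Y<))) (eq p₀ e r SA SB Y c F)
    where
    eq : ∀ p₀ e r SA SB Y c F →
      (c + 2) * F + 1 + (p₀ + ((e + (e + r)) + (SA + SB)) + (F + (Y + (c + 1) * F + F))) + 0 ≡
      SA + e + F + (2 * ((c + 2) * F) + (r + (p₀ + (SB + e) + (1 + Y))))
    eq = solve-∀

  topLoss : ∀ p₀ SAe w EZ EW Y C F → p₀ + w ≤ Y + (C + 1) * F → suc Y ≤ F → SAe ≡ w + (EZ + EW) →
    suc (p₀ + SAe) ≤ EZ + EW + (C + 2) * F
  topLoss p₀ _ w EZ EW Y C F a Y< refl = linear 0 (+-mono-≤ a Y<) (eq p₀ w EZ EW Y C F)
    where
    eq : ∀ p₀ w EZ EW Y C F →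
      1 + (p₀ + (w + (EZ + EW))) + (Y + (C + 1) * F + F) + 0 ≡
      EZ + EW + (C + 2) * F + (p₀ + w + (1 + Y))
    eq = solve-∀

  -- `1 + 2 * q + C` is `cost 2 (suc m)` unfolded. Of this plus 2, the lower levels account for C +
  -- 2 and the `F` on the right for one, which leaves 2 q.
  topLoss> : ∀ p₀ SA e E q C F → ((1 + 2 * q + C) + 2) * F + 1 ≤ SA + e + F →
    suc (p₀ + (SA + e)) ≤ E + (C + 2) * F → 2 * q * F + 2 ≤ E
  topLoss> p₀ SA e E q C F d t = linear p₀ (+-mono-≤ d t) (eq p₀ SA e E q C F)
    where
    eq : ∀ p₀ SA e E q C F →
      2 * q * F + 2 + (SA + e + F + (E + (C + 2) * F)) + p₀ ≡
      E + (((1 + 2 * q + C) + 2) * F + 1 + (1 + (p₀ + (SA + e))))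
    eq = solve-∀

  -- Each gathering spends F + 1 on its first pebble, and 2 q F + 2 - 2 (F + 1) = (2 q - 2) F.
  leftovers : ∀ EZ EW QZ QW g q F → 2 + g ≡ 2 * q → 2 * q * F + 2 ≤ EZ + EW →
    EZ ≤ QZ + 1 * F + 1 → EW ≤ QW + 1 * F + 1 → g * F ≤ QZ + QW
  leftovers EZ EW QZ QW g q F 2+g t z w = linear 0
    (+-mono-≤ (subst (λ k → k * F + 2 ≤ EZ + EW) (sym 2+g) t) (+-mono-≤ z w)) (eq EZ EW QZ QW g F)
    where
    eq : ∀ EZ EW QZ QW g F →
      g * F + (EZ + EW + (QZ + 1 * F + 1 + (QW + 1 * F + 1))) + 0 ≡
      QZ + QW + ((2 + g) * F + 2 + (EZ + EW))
    eq = solve-∀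

  pendant> : ∀ EZ EW g q F → 2 + g ≡ 2 * q → 2 * q * F + 2 ≤ EZ + EW → EZ ≤ F →
    suc (suc g * F) ≤ EW
  pendant> EZ EW g q F 2+g t z = linear 1
    (+-mono-≤ (subst (λ k → k * F + 2 ≤ EZ + EW) (sym 2+g) t) z) (eq EZ EW g F)
    where
    eq : ∀ EZ EW g F → 1 + (1 + g) * F + (EZ + EW + F) + 1 ≡ EW + ((2 + g) * F + 2 + EZ)
    eq = solve-∀

  -- With c = 1 + 2 q + C, the dropped far end, the losses of the pendant, the antipode and both
  -- arms, and the pebbles left at the target make at most (2 c + 3) F, which is F short of the
  -- total.
  farPendant : ∀ p₀ e E pm hW EW R SB Y₁ Y₂ Q Qc g q C F → 2 + g ≡ 2 * q →
    2 * (((1 + 2 * q + C) + 2) * F) ≤ p₀ + ((e + E) + (pm + ((hW + EW) + R) + SB)) →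
    p₀ + (R + hW) ≤ Y₁ + (C + 1) * F →
    Y₁ + (SB + e) ≤ Y₂ + ((1 + 2 * q + C) + 1) * F → suc Y₂ ≤ F →
    EW ≤ Q + suc g * F + 1 → E ≤ Qc + 1 * F + 1 → suc (pm + Q + Qc) ≤ F → ¬ 1 ≤ F
  farPendant p₀ e E pm hW EW R SB Y₁ Y₂ Q Qc g q C F 2+g T a b Y< w c s 1≤F =
    contradiction (linear {R = 0} 0
      (+-mono-≤ (subst (λ k → 2 * (((1 + k + C) + 2) * F) ≤
        p₀ + ((e + E) + (pm + ((hW + EW) + R) + SB))) (sym 2+g) T)
      (+-mono-≤ a (+-mono-≤ (subst (λ k → Y₁ + (SB + e) ≤ Y₂ + ((1 + k + C) + 1) * F) (sym 2+g) b)
      (+-mono-≤ Y< (+-mono-≤ w (+-mono-≤ c (+-mono-≤ s 1≤F)))))))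
      (eq p₀ e E pm hW EW R SB Y₁ Y₂ Q Qc g C F)) (1+n≰n {0})
    where
    eq : ∀ p₀ e E pm hW EW R SB Y₁ Y₂ Q Qc g C F →
      1 + (p₀ + ((e + E) + (pm + ((hW + EW) + R) + SB)) + (Y₁ + (C + 1) * F +
        (Y₂ + ((1 + (2 + g) + C) + 1) * F + (F + (Q + (1 + g) * F + 1 + (Qc + 1 * F + 1 + (F + F))))))) + 0 ≡
      0 + (2 * (((1 + (2 + g) + C) + 2) * F) + (p₀ + (R + hW) + (Y₁ + (SB + e) +
        (1 + Y₂ + (EW + (E + (1 + (pm + Q + Qc) + 1))))))) 
    eq = solve-∀

  smallPendant : ∀ p₀ SA e E EW q C F → suc (p₀ + (SA + e)) ≤ E + EW + (C + 2) * F →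
    ((1 + 2 * q + C) + 2) * F + 1 ≤ SA + e + F → EW ≤ F → 1 * F ≤ q * F → suc (q * F) ≤ E
  smallPendant p₀ SA e E EW q C F t d w F≤qF =
    linear (p₀ + 1) (+-mono-≤ t (+-mono-≤ d (+-mono-≤ w F≤qF))) (eq p₀ SA e E EW q C F)
    where
    eq : ∀ p₀ SA e E EW q C F →
      1 + q * F + (E + EW + (C + 2) * F + (SA + e + F + (F + q * F))) + (p₀ + 1) ≡
      E + (1 + (p₀ + (SA + e)) + (((1 + 2 * q + C) + 2) * F + 1 + (EW + 1 * F)))
    eq = solve-∀

  -- C₁ is `cost 1 m`, that is C + 1 - q. After the losses of the top level, R + hW + Q is still at
  -- least (C₁ + 1) F.
  heavyRest : ∀ p₀ SAe EZ hW EW R Q Q′ q C C₁ F → C₁ + q ≡ C + 1 →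
    (2 * C + 6) * F ≤ p₀ + SAe + ((hW + EW) + R) → EZ ≤ Q + q * F + 1 →
    suc (p₀ + SAe) ≤ EZ + EW + (C + 2) * F → EW ≤ F → R + hW + Q ≤ Q′ + C₁ * F → F ≤ Q′
  heavyRest p₀ SAe EZ hW EW R Q Q′ q C C₁ F C₁+q h z t w r =
    linear 0 (+-mono-≤ h (+-mono-≤ z (+-mono-≤ t (+-mono-≤ w (+-mono-≤ w (+-mono-≤ r C₁q))))))
      (eq p₀ SAe EZ hW EW R Q Q′ q C C₁ F)
    where
    C₁q : (C₁ + q) * F ≤ (C + 1) * F
    C₁q = ≤-reflexive (cong (_* F) C₁+q)
    eq : ∀ p₀ SAe EZ hW EW R Q Q′ q C C₁ F →
      F + (p₀ + SAe + ((hW + EW) + R) + (Q + q * F + 1 + (EZ + EW + (C + 2) * F + (F + (F + (Q′ + C₁ * F + (C + 1) * F)))))) + 0 ≡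
      Q′ + ((2 * C + 6) * F + (EZ + (1 + (p₀ + SAe) + (EW + (EW + (R + hW + Q + (C₁ + q) * F))))))
    eq = solve-∀

  -- The total is (4 q + 2 C + 6) F, so at least 4 q F lies beyond the light part; the first pebble
  -- from the antipode uses up F of it.
  lightRest : ∀ p₀ e E pm WR SB Qc g q C F → suc g ≡ 2 * (2 * q) →
    suc (p₀ + (pm + WR + e) + WR) ≤ (2 * C + 6) * F → E ≤ Qc + 1 * F + 1 → SB ≤ pm + WR →
    2 * (((1 + 2 * q + C) + 2) * F) ≤ p₀ + ((e + E) + (pm + WR + SB)) → g * F ≤ pm + Qc
  lightRest p₀ e E pm WR SB Qc g q C F 1+g l c b T =
    linear 0 (+-mono-≤ (≤-reflexive (cong (_* F) 1+g)) (+-mono-≤ l (+-mono-≤ c (+-mono-≤ b T))))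
      (eq p₀ e E pm WR SB Qc g q C F)
    where
    eq : ∀ p₀ e E pm WR SB Qc g q C F →
      g * F + (2 * (2 * q) * F + ((2 * C + 6) * F + (Qc + 1 * F + 1 + (pm + WR + (p₀ + ((e + E) + (pm + WR + SB))))))) + 0 ≡
      pm + Qc + ((1 + g) * F + (1 + (p₀ + (pm + WR + e) + WR) + (E + (SB + 2 * (((1 + 2 * q + C) + 2) * F)))))
    eq = solve-∀

-- Targets over the vertices of the cycle.

module VertexTarget (K G : Graph) (F : ℕ) (suffices : Suffices G F)
  (oddTwo : ∀ D → 2 * F < size G D + oddCount G D → ∀ y → CanPlace G 2 y D)
  (y : Graph.V G) (t : Graph.V K) where

  private
    module K = Graph K
    module PG = Pebbling G

  open PG using (pt; pt-join)
  open Fibre G F suffices oddTwo y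
  open Columns K G F suffices oddTwo y

  goal : Config
  goal = col t (pt y 1)

  -- Allows the vertex target to be treated by contradiction.
  ⇒goal? : ∀ s → Dec (s ⇒ goal)
  ⇒goal? s = map′ to from (Existence.canPlace? (K □ G) 1 (t , y) (size (K □ G) ⟦ s ⟧) ⟦ s ⟧ refl)
    where
    open Pebbling (K □ G) using (canPlace⇒⟶; ⟶⇒canPlace) renaming (_⨾_ to _⨟_; forget to drop)
    to : CanPlace (K □ G) 1 (t , y) ⟦ s ⟧ → s ⇒ goal
    to p = run (canPlace⇒⟶ p ⨟ drop λ z → ≤-reflexive (column-pt t y 1 z))
    from : s ⇒ goal → CanPlace (K □ G) 1 (t , y) ⟦ s ⟧
    from (run p) = ⟶⇒canPlace (p ⨟ drop λ z → ≤-reflexive (sym (column-pt t y 1 z)))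

  double⇒ : ∀ {a b k} → K.Adj a b → col a (pt y (k + k)) ⇒ col b (pt y k)
  double⇒ {k = k} e = lift (PG.forget λ w → ≤-reflexive (sym (PG.pt-+ y k k w))) ⨾ cross e

  join : ∀ {a j k} → col a (pt y j) ∙ col a (pt y k) ⇒ col a (pt y (j + k))
  join {j = j} {k} = merge ⨾ lift (pt-join y j k)

  exchange : ∀ {s₁ s₂ s₃ s₄} → (s₁ ∙ s₂) ∙ (s₃ ∙ s₄) ⇒ (s₁ ∙ s₃) ∙ (s₂ ∙ s₄)
  exchange = assocʳ ⨾ idle ∥ (assocˡ ⨾ swap ∥ idle ⨾ assocʳ) ⨾ assocˡ

  -- `absorb` expects a remainder beside the arm; an empty copy serves when none is left.
  pad : ∀ {s} → s ⇒ s ∙ col t ∅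
  pad {s} = run (Pebbling.forget (K □ G) λ z →
    ≤-reflexive (trans (cong (⟦ s ⟧ z +_) (column-∅ t z)) (+-identityʳ (⟦ s ⟧ z))))

  fewer : ∀ {a j k} → j ≤ k → col a (pt y k) ⇒ col a (pt y j)
  fewer j≤k = lift (PG.forget (PG.pt-mono y j≤k))

  record RootedArm : Set where
    field
      arm               : Arm K
      root              : K.Adj (Arm.path arm 0) t
      pathLoad pendLoad : ℕ → Distribution G
    open Arm arm public
    open Load arm pathLoad pendLoad public

    arrive : ∀ {k} j → 2 * 2 ^ j ≤ k → col (path j) (pt y k) ⇒ goal
    arrive j enough = fewer enough ⨾ descend arm 2 j ⨾ double⇒ {k = 1} root

    load : ℕ → ℕ
    load j = weight j (pathLoad j)

  module Unsolved (Ω : Config) (unsolved : ¬ (Ω ⇒ goal)) where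

    few : ∀ {Y} → Ω ⇒ col t Y → suc (size G Y) ≤ F
    few {Y} r = ≰⇒> λ F≤ → unsolved (r ⨾ many-at t 1 Y (≤-trans (≤-reflexive (*-identityˡ F)) F≤))

    record Absorbed (Y : Distribution G) (s : Config) (w loss : ℕ) : Set where
      field
        result : Distribution G
        plays  : Ω ⇒ col t result ∙ s
        bound  : size G Y + w ≤ size G result + loss * F

    -- The edge from the arm to the target costs F more.
    absorb : ∀ A {Y s} j Z → Ω ⇒ col t Y ∙ (RootedArm.caterpillar A j Z ∙ s) →
      Absorbed Y s (RootedArm.weight A j Z) (cost 2 j + 1)
    absorb A {Y} {s} j Z r = case (collapse 2 j Z)
      where
      open RootedArm A
      last : ∀ Q → (caterpillar j Z ⇒ col (path 0) Q) → weight j Z ≤ size G Q + cost 2 j * F →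
        ∀ h → col (path 0) Q ⇒ col t (pt y h) → loss Q ≤ suc h * F →
        Absorbed Y s (weight j Z) (cost 2 j + 1)
      -- A single pebble delivered across the last edge would solve the target; so h = 0, and the
      -- root loses at most F.
      last Q q bound (suc h) sendQ _ =
        ⊥-elim (unsolved (r ⨾ keepʳ ⨾ keepˡ ⨾ q ⨾ sendQ ⨾ fewer (s≤s z≤n)))
      last Q q bound zero _ lossQ = record
        { result = Y ⊕ half Q
        ; plays  = r ⨾ assocˡ ⨾ (idle ∥ (q ⨾ push root Q) ⨾ merge) ∥ idle
        ; bound  = account (size G Y) (weight j Z) (cost 2 j) (size-half+loss Q) bound lossQ (PG.size-⊕ Y (half Q)) }
        where
        account : ∀ a w c {b l q r} → q ≡ b + l → w ≤ q + c * F → l ≤ 1 * F → r ≡ a + b →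
          a + w ≤ r + (c + 1) * F
        account a w c {b} {l} refl p lossQ refl =
          linear 0 (+-mono-≤ p lossQ) (eq a w b c l F)
          where
          eq : ∀ a w b c l F → a + w + (b + l + c * F + 1 * F) + 0 ≡ a + b + (c + 1) * F + (w + l)
          eq = solve-∀
      case : Collapses 2 j Z → Absorbed Y s (weight j Z) (cost 2 j + 1)
      case (inj₁ done) = ⊥-elim (unsolved (r ⨾ keepʳ ⨾ keepˡ ⨾ done ⨾ double⇒ {k = 1} root))
      case (inj₂ (Q , q , bound)) = let h , sendQ , lossQ = send root Q in last Q q bound h sendQ lossQ

  module TwoArms (A B : RootedArm) (c : K.V) (m : ℕ)
    (cA : K.Adj c (RootedArm.path A (suc m))) (cB : K.Adj c (RootedArm.path B (suc m)))
    (X₀ Xc : Distribution G) where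

    private
      module A = RootedArm A
      module B = RootedArm B

    Ω : Config
    Ω = col t X₀ ∙ (col c Xc ∙ (A.caterpillar (suc m) (A.pathLoad (suc m)) ∙
                                B.caterpillar (suc m) (B.pathLoad (suc m))))

    total : ℕ
    total = size G X₀ + (size G Xc + (A.load (suc m) + B.load (suc m)))

    module Contradiction (heavier : B.load (suc m) ≤ A.load (suc m))
      (enough : 2 * ((cost 2 (suc m) + 2) * F) ≤ total) (unsolved : ¬ (Ω ⇒ goal)) where

      open Unsolved Ω unsolved
      open Arithmetic

      Top W : Distribution G
      Top = A.pathLoad (suc m)
      W   = A.pendLoad m

      p₀ e E SA SB pm R q C : ℕ
      p₀ = size G X₀
      e  = size G (half Xc)
      E  = loss Xc
      SA = A.load (suc m)
      SB = B.load (suc m)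
      pm = size G Top
      R  = A.load m
      q  = 2 ^ m
      C  = cost 2 m

      Z : Distribution G
      Z = Top ⊕ half Xc

      enough′ : 2 * ((cost 2 (suc m) + 2) * F) ≤ p₀ + ((e + E) + (SA + SB))
      enough′ = subst (λ k → 2 * ((cost 2 (suc m) + 2) * F) ≤ p₀ + (k + (SA + SB))) (size-half+loss Xc) enough

      SA≡ : SA ≡ pm + ((size G (half W) + loss W) + R)
      SA≡ = cong (λ k → pm + (k + R)) (size-half+loss W)

      pushA : Ω ⇒ col t X₀ ∙ (A.caterpillar (suc m) Z ∙ B.caterpillar (suc m) (B.pathLoad (suc m)))
      pushA = idle ∥ (push cA Xc ∥ idle ⨾ assocˡ ⨾ A.add-top (suc m) (half Xc) Top ∥ idle)

      pushB : Ω ⇒ col t X₀ ∙ (B.caterpillar (suc m) (B.pathLoad (suc m) ⊕ half Xc) ∙ A.caterpillar (suc m) Top)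
      pushB = idle ∥ (push cB Xc ∥ swap ⨾ assocˡ ⨾ B.add-top (suc m) (half Xc) (B.pathLoad (suc m)) ∥ idle)

      weightZ : A.weight (suc m) Z ≡ SA + e
      weightZ = A.weight-⊕ (suc m) Top (half Xc)

      -- Otherwise the pairs of the antipode join `A` at a loss of at most F, and folding both arms
      -- leaves F pebbles at the target.
      antipodeLoss> : suc F ≤ E
      antipodeLoss> = ≰⇒> λ E≤F →
        let open Absorbed
            a = absorb A (suc m) Z pushA
            b = absorb B (suc m) (B.pathLoad (suc m)) (plays a ⨾ idle ∥ pad)
        in bothArms p₀ e E SA SB (size G (result a)) (size G (result b)) (cost 2 (suc m)) F enough′ E≤F
             (subst (λ k → p₀ + k ≤ size G (result a) + (cost 2 (suc m) + 1) * F) weightZ (bound a))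
             (bound b) (few (plays b ⨾ keepˡ))

      -- Now the pairs of the antipode go to `B`. That `B` still fails bounds its weight, so the
      -- remainder must lie in `A` and the antipode.
      nearlyFull : (cost 2 (suc m) + 2) * F + 1 ≤ SA + e + F
      nearlyFull =
        let open Absorbed
            b = absorb B (suc m) (B.pathLoad (suc m) ⊕ half Xc) pushB
        in deficit p₀ e (size G (parity Xc)) SA SB (size G (result b)) (cost 2 (suc m)) F enough′ (parity≤F Xc)
             (subst (λ k → p₀ + k ≤ size G (result b) + (cost 2 (suc m) + 1) * F)
               (B.weight-⊕ (suc m) (B.pathLoad (suc m)) (half Xc)) (bound b))
             (few (plays b ⨾ keepˡ))

      -- Only the top level is folded separately; the levels below and the root edge lose at most (C
      -- + 1) F, and fewer than F pebbles are left at the target.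
      foldLoss : suc (p₀ + (SA + e)) ≤ (loss Z + loss W) + (C + 2) * F
      foldLoss =
        let open Absorbed
            a = absorb A m (A.pathLoad m ⊕ half W ⊕ half Z) (pushA ⨾ idle ∥ (A.fold-level m Z ∥ idle))
        in topLoss p₀ (SA + e) (A.weight m (A.pathLoad m ⊕ half W ⊕ half Z)) (loss Z) (loss W)
             (size G (result a)) C F (bound a) (few (plays a ⨾ keepˡ))
             (trans (sym weightZ) (A.weight-fold m Z))

      -- As in `collapse`, a top level that cannot bring 2 q pebbles to y at `path m` loses at most
      -- (2 q + 1) F; this one is within F of that.
      foldLoss> : 2 * q * F + 2 ≤ loss Z + loss W
      foldLoss> = topLoss> p₀ SA e (loss Z + loss W) q C F nearlyFull foldLoss

      q-2 : ∃ λ g → 2 + g ≡ 2 * q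
      q-2 = m≤n⇒∃[o]m+o≡n (*-monoʳ-≤ 2 (m^n>0 2 m))

      1* : ∀ {x} → suc F ≤ x → suc (1 * F) ≤ x
      1* {x} = subst (λ k → suc k ≤ x) (sym (*-identityˡ F))

      -- Each brings one pebble to y; the leftovers bring the other 2q − 2.
      bigBig : suc F ≤ loss Z → suc F ≤ loss W → ⊥
      bigBig bigZ bigW =
        let QZ , sendZ , lossZ = gather-across (A.path-adj m) 0 Z (1* bigZ)
            QW , sendW , lossW = gather-across (A.pendant-adj m) 0 W (1* bigW)
            g , 2+g = q-2
            leftover = leftovers (loss Z) (loss W) (size G QZ) (size G QW) g q F 2+g foldLoss> lossZ lossW
        in unsolved (pushA ⨾ keepʳ ⨾ keepˡ ⨾
             sendZ ∥ (sendW ∥ idle ⨾ keepˡ) ⨾ exchange ⨾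
             join ∥ (merge ⨾ many-at _ g (QZ ⊕ QW) (≤-trans leftover (≤-reflexive (sym (PG.size-⊕ QZ QW))))) ⨾
             join ⨾ A.arrive m (≤-reflexive (sym 2+g)))

      -- The pendant brings 2q − 1 pebbles to y.  The missing one comes from the
      -- far end, helped by one pebble of the antipode, unless the far end and
      -- the antipode are so light that the former may be dropped and the latter
      -- sent to the other arm.
      bigPendant : loss Z ≤ F → ⊥
      bigPendant smallZ =
        let g , 2+g = q-2
            Q , sendW , lossW = gather-at (A.pendant m) g W (pendant> (loss Z) (loss W) g q F 2+g foldLoss> smallZ)
            Qc , sendC , lossC = gather-across cA 0 Xc (1* antipodeLoss>)
        in decide g 2+g Q sendW lossW Qc sendC lossC (F ≤? pm + size G Q + size G Qc)
        where
        decide : ∀ g → 2 + g ≡ 2 * q →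
          ∀ Q → (col (A.pendant m) W ⇒ col (A.pendant m) (double (pt y (suc g))) ∙ col (A.pendant m) (double Q)) →
          loss W ≤ size G Q + suc g * F + 1 →
          ∀ Qc → (col c Xc ⇒ col (A.path (suc m)) (pt y 1) ∙ col (A.path (suc m)) Qc) →
          E ≤ size G Qc + 1 * F + 1 → Dec (F ≤ pm + size G Q + size G Qc) → ⊥
        decide g 2+g Q sendW lossW Qc sendC lossC (yes F≤) =
          -- The pendant is adjacent to both ends of the last path edge: its pebbles for y go to
          -- `path m`, while its free pairs go back to the far end.
          unsolved (keepʳ ⨾ assocˡ ⨾ keepˡ ⨾
            sendC ∥ (idle ∥ (sendW ∥ idle ⨾ keepˡ ⨾ cross (A.pendant-adj m) ∥ cross (A.pendant-adj⁺ m))) ⨾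
            reorder ⨾
            (join′ ∥ idle) ⨾ join ⨾ A.arrive m (≤-reflexive (sym 2+g)))
          where
          top′ : Distribution G
          top′ = Top ⊕ Q ⊕ Qc
          size-top′ : size G top′ ≡ pm + size G Q + size G Qc
          size-top′ = trans (PG.size-⊕ (Top ⊕ Q) Qc) (cong (_+ size G Qc) (PG.size-⊕ Top Q))
          -- One pebble from the antipode and one from F pebbles at the far end make one at
          -- `path m`, which completes the 2 q - 1 of the pendant.
          join′ : col (A.path (suc m)) (pt y 1) ∙ col (A.path (suc m)) top′ ⇒ col (A.path m) (pt y 1)
          join′ = idle ∥ many-at _ 1 top′ (≤-trans (≤-reflexive (*-identityˡ F)) (≤-trans F≤ (≤-reflexive (sym size-top′)))) ⨾
            join ⨾ double⇒ {k = 1} (A.path-adj m)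
          reorder : ∀ {a b k} → (col a (pt y 1) ∙ col a Qc) ∙ (col a Top ∙ (col b (pt y k) ∙ col a Q)) ⇒
            (col a (pt y 1) ∙ col a top′) ∙ col b (pt y k)
          reorder = idle ∥ (idle ∥ swap ⨾ assocˡ ⨾ merge ∥ idle) ⨾ assocʳ ⨾
            idle ∥ (assocˡ ⨾ (swap ⨾ merge) ∥ idle) ⨾ assocˡ
        decide g 2+g Q sendW lossW Qc sendC lossC (no F≰) =
          let open Absorbed
              a = absorb A m (A.pathLoad m ⊕ half W)
                    (pushB ⨾ idle ∥ (swap ⨾ (keepʳ ⨾ push (A.pendant-adj m) W ∥ idle ⨾ A.add-top m (half W) (A.pathLoad m)) ∥ idle))
              b = absorb B (suc m) (B.pathLoad (suc m) ⊕ half Xc) (plays a ⨾ idle ∥ pad)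
          in farPendant p₀ e E pm (size G (half W)) (loss W) R SB (size G (result a)) (size G (result b))
               (size G Q) (size G Qc) g q C F 2+g
               (subst (λ k → 2 * ((cost 2 (suc m) + 2) * F) ≤ p₀ + ((e + E) + (k + SB))) SA≡ enough′)
               (subst (λ k → p₀ + k ≤ size G (result a) + (C + 1) * F) (A.weight-⊕ m (A.pathLoad m) (half W)) (bound a))
               (subst (λ k → size G (result a) + k ≤ size G (result b) + (cost 2 (suc m) + 1) * F)
                 (B.weight-⊕ (suc m) (B.pathLoad (suc m)) (half Xc)) (bound b))
               (few (plays b ⨾ keepˡ)) lossW lossC (≰⇒> F≰) 0<F

      F≤qF : 1 * F ≤ q * F
      F≤qF = *-monoˡ-≤ F (m^n>0 2 m)

      pred≡ : ∀ {k} → 1 ≤ k → ∃ λ g → suc g ≡ k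
      pred≡ 1≤k = m≤n⇒∃[o]m+o≡n 1≤k

      -- If the rest of the arm is heavy, the far end brings one pebble to y at
      -- the root and all leftovers another one.  Otherwise the far end alone
      -- brings 4q − 1 pebbles to y, and the antipode one more.
      smallPendant⊥ : loss W ≤ F → ⊥
      -- (2 C + 6) F is the required total less 4 q F, where 4 q pebbles at y are what the far end
      -- needs to solve the target.
      smallPendant⊥ smallW = decide ((2 * C + 6) * F ≤? p₀ + (SA + e) + (size G W + R))
        where
        decide : Dec ((2 * C + 6) * F ≤ p₀ + (SA + e) + (size G W + R)) → ⊥
        decide (yes heavy) =
          -- At `path m`, q pebbles at y are worth one at the root.
          let g , 1+g = pred≡ (m^n>0 2 m)
              Q , sendZ , lossZ = gather-across (A.path-adj m) g Z
                (subst (λ k → suc (k * F) ≤ loss Z) (sym 1+g)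
                  (smallPendant p₀ SA e (loss Z) (loss W) q C F foldLoss nearlyFull smallW F≤qF))
          in case Q (sendZ ⨾ fewer (≤-reflexive (sym 1+g)) ∥ idle)
               (subst (λ k → loss Z ≤ size G Q + k * F + 1) 1+g lossZ)
               (A.collapse 1 m (A.pathLoad m ⊕ half W ⊕ Q))
          where
          case : ∀ Q → (col (A.path (suc m)) Z ⇒ col (A.path m) (pt y q) ∙ col (A.path m) Q) →
            loss Z ≤ size G Q + q * F + 1 → A.Collapses 1 m (A.pathLoad m ⊕ half W ⊕ Q) → ⊥
          case Q sendZ lossZ collapsed = finish collapsed
            where
            toRoot : col (A.path m) (pt y q) ⇒ col (A.path 0) (pt y 1)
            toRoot = fewer (≤-reflexive (*-identityˡ q)) ⨾ descend A.arm 1 m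
            start : Ω ⇒ col (A.path m) (pt y q) ∙ A.caterpillar m (A.pathLoad m ⊕ half W ⊕ Q)
            start = pushA ⨾ keepʳ ⨾ keepˡ ⨾
              sendZ ∥ (push (A.pendant-adj m) W ∥ idle ⨾ A.add-top m (half W) (A.pathLoad m)) ⨾
              assocʳ ⨾ idle ∥ A.add-top m Q (A.pathLoad m ⊕ half W)
            done : Ω ⇒ col (A.path 0) (pt y 1) ∙ col (A.path 0) (pt y 1) → ⊥
            done r = unsolved (r ⨾ join ⨾ double⇒ {k = 1} A.root)
            finish : A.Collapses 1 m (A.pathLoad m ⊕ half W ⊕ Q) → ⊥
            finish (inj₁ r) = done (start ⨾ toRoot ∥ r)
            -- If folding does not deliver the second pebble, it leaves at least F pebbles at the
            -- root, and these bring it to y.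
            finish (inj₂ (Q′ , r , bound)) = done (start ⨾ toRoot ∥ (r ⨾ many-at (A.path 0) 1 Q′
              (≤-trans (≤-reflexive (*-identityˡ F)) (heavyRest p₀ (SA + e) (loss Z) (size G (half W)) (loss W) R
                (size G Q) (size G Q′) q C (cost 1 m) F (cost-1-2 m)
                (subst (λ k → (2 * C + 6) * F ≤ p₀ + (SA + e) + (k + R)) (size-half+loss W) heavy)
                lossZ foldLoss smallW
                (subst (_≤ size G Q′ + cost 1 m * F)
                  (trans (A.weight-⊕ m (A.pathLoad m ⊕ half W) Q) (cong (_+ size G Q) (A.weight-⊕ m (A.pathLoad m) (half W))))
                  bound)))))
        decide (no light) =
          let g , 1+g = pred≡ (m^n>0 2 (suc (suc m)))
              Qc , sendC , lossC = gather-across cA 0 Xc (1* antipodeLoss>)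
          in unsolved (keepʳ ⨾ assocˡ ⨾ keepˡ ⨾ sendC ∥ keepˡ ⨾ assocʳ ⨾
               idle ∥ (swap ⨾ merge ⨾ many-at _ g (Top ⊕ Qc)
                 (≤-trans (lightRest p₀ e E pm (size G W + R) SB (size G Qc) g q C F 1+g (≰⇒> light) lossC heavier enough′)
                          (≤-reflexive (sym (PG.size-⊕ Top Qc))))) ⨾
               join ⨾ A.arrive (suc m) (≤-reflexive (sym 1+g)))

      impossible : ⊥
      impossible with loss W ≤? F | loss Z ≤? F
      ... | yes smallW | _          = smallPendant⊥ smallW
      ... | no bigW    | yes smallZ = bigPendant smallZ
      ... | no bigW    | no bigZ    = bigBig (≰⇒> bigZ) (≰⇒> bigW)

    solvable : B.load (suc m) ≤ A.load (suc m) →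
      2 * ((cost 2 (suc m) + 2) * F) ≤ total → Ω ⇒ goal
    solvable heavier enough = decidable-stable (⇒goal? Ω) (Contradiction.impossible heavier enough)

  solve-twoArms : (A B : RootedArm) (c : K.V) (m : ℕ) →
    K.Adj c (RootedArm.path A (suc m)) → K.Adj c (RootedArm.path B (suc m)) → ∀ X₀ Xc →
    2 * ((cost 2 (suc m) + 2) * F) ≤ size G X₀ + (size G Xc +
      (RootedArm.load A (suc m) + RootedArm.load B (suc m))) →
    col t X₀ ∙ (col c Xc ∙
      (RootedArm.caterpillar A (suc m) (RootedArm.pathLoad A (suc m)) ∙
       RootedArm.caterpillar B (suc m) (RootedArm.pathLoad B (suc m)))) ⇒ goal
  solve-twoArms A B c m cA cB X₀ Xc enough
    with ≤-total (RootedArm.load B (suc m)) (RootedArm.load A (suc m))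
  ... | inj₁ B≤A = TwoArms.solvable A B c m cA cB X₀ Xc B≤A enough
  ... | inj₂ A≤B = idle ∥ (idle ∥ swap) ⨾ TwoArms.solvable B A c m cB cA X₀ Xc A≤B
        (subst (λ k → 2 * ((cost 2 (suc m) + 2) * F) ≤ size G X₀ + (size G Xc + k))
          (+-comm (RootedArm.load A (suc m)) (RootedArm.load B (suc m))) enough)

  -- Targets over the inserted vertices.

  module InnerTarget (A B : Arm K) (XA WA XB WB : ℕ → Distribution G)
    (rootA : Arm.path A 0 ≡ t) (rootB : Arm.path B 0 ≡ t)
    (n : ℕ) (z : K.V) (z-adj : K.Adj z (Arm.path B n)) (Z : Distribution G) where

    private
      module A = Arm A
      module B = Arm B
      module LA = Load A XA WA
      module LB = Load B XB WB

    -- In the cycle `z` lies between the far ends of the two arms. It is attached to the shorter arm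
    -- `B` as an additional pendant, used only through its edge to `B.path n`.
    Ω : Config
    Ω = LA.caterpillar (suc n) (XA (suc n)) ∙ (col z Z ∙ LB.caterpillar n (XB n))

    total : ℕ
    total = LA.weight (suc n) (XA (suc n)) + (size G Z + LB.weight n (XB n))

    account : ∀ QA QB wA wB c₁ c₂ p h l → (c₁ + p + c₂ + 1) * F ≤ wA + ((h + l) + wB) →
      wA ≤ QA + c₁ * F → l ≤ p * F → wB + h ≤ QB + c₂ * F → 1 * F ≤ QA + QB
    account QA QB wA wB c₁ c₂ p h l T a z b =
      linear 0 (+-mono-≤ T (+-mono-≤ a (+-mono-≤ z b))) (eq QA QB wA wB c₁ c₂ p h l F)
      where
      eq : ∀ QA QB wA wB c₁ c₂ p h l F →
        1 * F + (wA + ((h + l) + wB) + (QA + c₁ * F + (p * F + (QB + c₂ * F)))) + 0 ≡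
        QA + QB + ((c₁ + p + c₂ + 1) * F + (wA + (l + (wB + h))))
      eq = solve-∀

    relabel : ∀ {a X} → a ≡ t → col a X ⇒ col t X
    relabel refl = idle

    -- If neither arm delivers, their losses are at most the two costs. The loss of `z` is at most
    -- 2ⁿ F, because 2ⁿ pebbles at y on the far end of `B` would descend to one. The last summand 1
    -- leaves F pebbles at the target.
    solve-inner : (cost 1 (suc n) + 2 ^ n + cost 1 n + 1) * F ≤ total → Ω ⇒ goal
    solve-inner enough = byA (LA.collapse 1 (suc n) (XA (suc n)))
      where
      byB : ∀ QA → (LA.caterpillar (suc n) (XA (suc n)) ⇒ col (A.path 0) QA) →
        LA.weight (suc n) (XA (suc n)) ≤ size G QA + cost 1 (suc n) * F → loss Z ≤ 2 ^ n * F →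
        LB.Collapses 1 n (XB n ⊕ half Z) → Ω ⇒ goal
      byB QA rA boundA lossZ (inj₁ done) =
        keepʳ ⨾ push z-adj Z ∥ idle ⨾ LB.add-top n (half Z) (XB n) ⨾ done ⨾ relabel rootB
      byB QA rA boundA lossZ (inj₂ (QB , rB , boundB)) =
        (rA ⨾ relabel rootA) ∥ (push z-adj Z ∥ idle ⨾ LB.add-top n (half Z) (XB n) ⨾ rB ⨾ relabel rootB) ⨾
        merge ⨾ many-at t 1 (QA ⊕ QB) (≤-trans
          (account (size G QA) (size G QB) _ (LB.weight n (XB n)) (cost 1 (suc n)) (cost 1 n) (2 ^ n)
            (size G (half Z)) (loss Z)
            (subst (λ k → (cost 1 (suc n) + 2 ^ n + cost 1 n + 1) * F ≤ LA.weight (suc n) (XA (suc n)) + (k + LB.weight n (XB n)))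
              (size-half+loss Z) enough)
            boundA lossZ
            (subst (_≤ size G QB + cost 1 n * F) (LB.weight-⊕ n (XB n) (half Z)) boundB))
          (≤-reflexive (sym (PG.size-⊕ QA QB))))
      byZ : ∀ QA → (LA.caterpillar (suc n) (XA (suc n)) ⇒ col (A.path 0) QA) →
        LA.weight (suc n) (XA (suc n)) ≤ size G QA + cost 1 (suc n) * F →
        ∀ h → col z Z ⇒ col (B.path n) (pt y h) → loss Z ≤ suc h * F → Dec (2 ^ n ≤ h) → Ω ⇒ goal
      byZ QA rA boundA h sendZ lossZ (yes 2ⁿ≤h) =
        keepʳ ⨾ keepˡ ⨾ sendZ ⨾ fewer (≤-trans (≤-reflexive (*-identityˡ (2 ^ n))) 2ⁿ≤h) ⨾
        descend B 1 n ⨾ relabel rootB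
      byZ QA rA boundA h sendZ lossZ (no 2ⁿ≰h) =
        byB QA rA boundA (≤-trans lossZ (*-monoˡ-≤ F (≰⇒> 2ⁿ≰h))) (LB.collapse 1 n (XB n ⊕ half Z))
      byA : LA.Collapses 1 (suc n) (XA (suc n)) → Ω ⇒ goal
      byA (inj₁ done) = keepˡ ⨾ done ⨾ relabel rootA
      byA (inj₂ (QA , rA , boundA)) =
        let h , sendZ , lossZ = send z-adj Z in byZ QA rA boundA h sendZ lossZ (2 ^ n ≤? h)

-- Sums over the cycle, read in both directions from a vertex.

iter : {A : Set} → (A → A) → ℕ → A → A
iter f zero    x = x
iter f (suc j) x = f (iter f j x)

iter-shift : {A : Set} (f : A → A) → ∀ j x → iter f j (f x) ≡ f (iter f j x)
iter-shift f zero    x = refl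
iter-shift f (suc j) x = cong f (iter-shift f j x)

iter-+ : {A : Set} (f : A → A) → ∀ a b x → iter f (a + b) x ≡ iter f a (iter f b x)
iter-+ f zero    b x = refl
iter-+ f (suc a) b x = cong f (iter-+ f a b x)

Σ< : (ℕ → ℕ) → ℕ → ℕ
Σ< h zero    = 0
Σ< h (suc n) = Σ< h n + h n

Σ<-cong : ∀ {g h} → (∀ j → g j ≡ h j) → ∀ n → Σ< g n ≡ Σ< h n
Σ<-cong eq zero    = refl
Σ<-cong eq (suc n) = cong₂ _+_ (Σ<-cong eq n) (eq n)

Σ<-head : ∀ h n → Σ< h (suc n) ≡ h 0 + Σ< (h ∘ suc) n
Σ<-head h zero    = sym (+-identityʳ (h 0))
Σ<-head h (suc n) = trans (cong (_+ h (suc n)) (Σ<-head h n)) (+-assoc (h 0) (Σ< (h ∘ suc) n) (h (suc n)))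

Σ<-+ : ∀ h a b → Σ< h (b + a) ≡ Σ< h a + Σ< (λ j → h (j + a)) b
Σ<-+ h a zero    = sym (+-identityʳ (Σ< h a))
Σ<-+ h a (suc b) = trans (cong (_+ h (b + a)) (Σ<-+ h a b)) (+-assoc (Σ< h a) _ (h (b + a)))

sum-allFin : ∀ n (g : Fin n → ℕ) (h : ℕ → ℕ) → (∀ i → h (toℕ i) ≡ g i) → sum (map g (allFin n)) ≡ Σ< h n
sum-allFin n g h eq = trans (cong sum (map-tabulate id g)) (go n g h eq)
  where
  go : ∀ n (g : Fin n → ℕ) (h : ℕ → ℕ) → (∀ i → h (toℕ i) ≡ g i) → sum (tabulate g) ≡ Σ< h n
  go zero    g h eq = refl
  go (suc n) g h eq = trans (cong₂ _+_ (sym (eq zero)) (go n (λ i → g (suc i)) (h ∘ suc) (λ i → eq (suc i))))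
    (sym (Σ<-head h n))

module Rotation (k : ℕ) where

  next^ prev^ : ℕ → Fin (suc k) → Fin (suc k)
  next^ = iter next

  -- The inverse of `next`, which has period k + 1.
  prev : Fin (suc k) → Fin (suc k)
  prev = next^ k

  prev^ = iter prev

  toℕ-next^ : ∀ j i → toℕ (next^ j i) ≡ (j + toℕ i) % suc k
  toℕ-next^ zero    i = sym (m<n⇒m%n≡m (Fin.toℕ<n i))
  toℕ-next^ (suc j) i = begin
    toℕ (next (next^ j i))                               ≡⟨ MiddleCycle.toℕ-next 0 (next^ j i) ⟩
    (1 + toℕ (next^ j i)) % suc k                        ≡⟨ cong (λ l → (1 + l) % suc k) (toℕ-next^ j i) ⟩
    (1 + (j + toℕ i) % suc k) % suc k                    ≡⟨ %-distribˡ-+ 1 ((j + toℕ i) % suc k) (suc k) ⟩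
    (1 % suc k + (j + toℕ i) % suc k % suc k) % suc k    ≡⟨ cong (λ l → (1 % suc k + l) % suc k) (m%n%n≡m%n (j + toℕ i) (suc k)) ⟩
    (1 % suc k + (j + toℕ i) % suc k) % suc k            ≡⟨ %-distribˡ-+ 1 (j + toℕ i) (suc k) ⟨
    (suc j + toℕ i) % suc k                              ∎
    where open ≡-Reasoning

  next^-period : ∀ i → next^ (suc k) i ≡ i
  next^-period i = Fin.toℕ-injective (begin
    toℕ (next^ (suc k) i)        ≡⟨ toℕ-next^ (suc k) i ⟩
    (suc k + toℕ i) % suc k      ≡⟨ cong (_% suc k) (+-comm (suc k) (toℕ i)) ⟩
    (toℕ i + suc k) % suc k      ≡⟨ [m+n]%n≡m%n (toℕ i) (suc k) ⟩
    toℕ i % suc k                ≡⟨ m<n⇒m%n≡m (Fin.toℕ<n i) ⟩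
    toℕ i                        ∎)
    where open ≡-Reasoning

  next-prev : ∀ i → next (prev i) ≡ i
  next-prev = next^-period

  prev-next : ∀ i → prev (next i) ≡ i
  prev-next i = trans (iter-shift next k i) (next^-period i)

  prev^-next^ : ∀ j i → prev^ j (next^ j i) ≡ i
  prev^-next^ zero    i = refl
  prev^-next^ (suc j) i = trans (sym (iter-shift prev j (next (next^ j i))))
    (trans (cong (prev^ j) (prev-next (next^ j i))) (prev^-next^ j i))

  orbit : (Fin (suc k) → ℕ) → Fin (suc k) → ℕ → ℕ
  orbit g i j = g (next^ j i)

  -- Adding `g i` to either side gives the sum of k + 2 consecutive terms, the last of which is
  -- `g i` again.
  orbit-next : ∀ g i → Σ< (orbit g (next i)) (suc k) ≡ Σ< (orbit g i) (suc k)
  orbit-next g i = +-cancelˡ-≡ (g i) _ _ (begin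
    g i + Σ< (orbit g (next i)) (suc k)              ≡⟨ cong (g i +_) (Σ<-cong (λ j → cong g (iter-shift next j i)) (suc k)) ⟩
    g i + Σ< (orbit g i ∘ suc) (suc k)               ≡⟨ Σ<-head (orbit g i) (suc k) ⟨
    Σ< (orbit g i) (suc k) + g (next^ (suc k) i)     ≡⟨ cong (λ l → Σ< (orbit g i) (suc k) + g l) (next^-period i) ⟩
    Σ< (orbit g i) (suc k) + g i                     ≡⟨ +-comm _ (g i) ⟩
    g i + Σ< (orbit g i) (suc k)                     ∎)
    where open ≡-Reasoning

  orbit-next^ : ∀ g j i → Σ< (orbit g (next^ j i)) (suc k) ≡ Σ< (orbit g i) (suc k)
  orbit-next^ g zero    i = refl
  orbit-next^ g (suc j) i = trans (orbit-next g (next^ j i)) (orbit-next^ g j i)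

  from-zero : ∀ i → next^ (toℕ i) zero ≡ i
  from-zero i = Fin.toℕ-injective (trans (toℕ-next^ (toℕ i) zero)
    (trans (cong (_% suc k) (+-identityʳ (toℕ i))) (m<n⇒m%n≡m (Fin.toℕ<n i))))

  sum-orbit : ∀ g i → sum (map g (allFin (suc k))) ≡ Σ< (orbit g i) (suc k)
  sum-orbit g i = begin
    sum (map g (allFin (suc k)))                              ≡⟨ sum-allFin (suc k) g (orbit g zero) (λ l → cong g (from-zero l)) ⟩
    Σ< (orbit g zero) (suc k)                        ≡⟨ orbit-next^ g (toℕ i) zero ⟨
    Σ< (orbit g (next^ (toℕ i) zero)) (suc k)        ≡⟨ cong (λ l → Σ< (orbit g l) (suc k)) (from-zero i) ⟩
    Σ< (orbit g i) (suc k)                                    ∎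
    where open ≡-Reasoning

  -- Reverses the order of summation, because a backward arm numbers its vertices by steps of
  -- `prev`.
  backwards : ∀ g b i → Σ< (orbit g i) b ≡ Σ< (λ j → g (prev^ (suc j) (next^ b i))) b
  backwards g zero    i = refl
  backwards g (suc b) i = begin
    Σ< (orbit g i) b + g (next^ b i)
      ≡⟨ +-comm (Σ< (orbit g i) b) (g (next^ b i)) ⟩
    g (next^ b i) + Σ< (orbit g i) b
      ≡⟨ cong₂ _+_ (cong g (sym (prev-next (next^ b i)))) (trans (backwards g b i) (Σ<-cong shifted b)) ⟩
    h 0 + Σ< (h ∘ suc) b
      ≡⟨ Σ<-head h b ⟨
    Σ< h (suc b) ∎
    where
    open ≡-Reasoning
    h : ℕ → ℕ
    h j = g (prev^ (suc j) (next^ (suc b) i))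
    shifted : ∀ j → g (prev^ (suc j) (next^ b i)) ≡ h (suc j)
    shifted j = cong (g ∘ prev) (trans (cong (prev^ j) (sym (prev-next (next^ b i))))
      (iter-shift prev j (next (next^ b i))))

  -- The b terms that follow the first a end where the cycle closes, so they can be read backwards
  -- from i.
  around : ∀ a b → b + a ≡ suc k → ∀ g i →
    sum (map g (allFin (suc k))) ≡ Σ< (orbit g i) a + Σ< (λ j → g (prev^ (suc j) i)) b
  around a b b+a g i = begin
    sum (map g (allFin (suc k)))                                        ≡⟨ sum-orbit g i ⟩
    Σ< (orbit g i) (suc k)                                              ≡⟨ cong (Σ< (orbit g i)) b+a ⟨
    Σ< (orbit g i) (b + a)                                              ≡⟨ Σ<-+ (orbit g i) a b ⟩
    Σ< (orbit g i) a + Σ< (λ j → g (next^ (j + a) i)) b                 ≡⟨ cong (Σ< (orbit g i) a +_) (Σ<-cong (λ j → cong g (iter-+ next j a i)) b) ⟩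
    Σ< (orbit g i) a + Σ< (orbit g (next^ a i)) b                       ≡⟨ cong (Σ< (orbit g i) a +_) (backwards g b (next^ a i)) ⟩
    Σ< (orbit g i) a + Σ< (λ j → g (prev^ (suc j) (next^ b (next^ a i)))) b
      ≡⟨ cong (λ l → Σ< (orbit g i) a + Σ< (λ j → g (prev^ (suc j) l)) b) home ⟩
    Σ< (orbit g i) a + Σ< (λ j → g (prev^ (suc j) i)) b                 ∎
    where
    open ≡-Reasoning
    home : next^ b (next^ a i) ≡ i
    home = trans (sym (iter-+ next b a i)) (trans (cong (λ l → next^ l i) b+a) (next^-period i))

-- Sums in the order in which `caterpillar` lists path vertices and pendants.
zigzag : (ℕ → ℕ) → (ℕ → ℕ) → ℕ → ℕ
zigzag a b zero    = a 0
zigzag a b (suc j) = a (suc j) + (b j + zigzag a b j)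

zigzag-Σ : ∀ a b j → zigzag a b j ≡ Σ< a (suc j) + Σ< b j
zigzag-Σ a b zero    = sym (+-identityʳ (a 0))
zigzag-Σ a b (suc j) = trans (cong (λ k → a (suc j) + (b j + k)) (zigzag-Σ a b j))
  (regroup (a (suc j)) (b j) (Σ< a (suc j)) (Σ< b j))
  where
  regroup : ∀ x y s t → x + (y + (s + t)) ≡ s + x + (t + y)
  regroup = solve-∀

module MiddleSum (m : ℕ) where
  n k : ℕ
  n = suc m
  k = m + (n + 0)

  open Rotation k

  sum-all : ∀ (φ : MiddleVertex (2 * n) → ℕ) → sum (map φ (MiddleCycle.all (2 * n))) ≡
    sum (map (φ ∘ v) (allFin (2 * n))) + sum (map (φ ∘ u) (allFin (2 * n)))
  sum-all φ = trans (cong sum (map-++ φ (map v (allFin (2 * n))) (map u (allFin (2 * n)))))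
    (trans (sum-++ (map φ (map v (allFin (2 * n)))) (map φ (map u (allFin (2 * n)))))
      (cong₂ (λ xs ys → sum xs + sum ys) (sym (map-∘ {g = φ} {f = v} (allFin (2 * n)))) (sym (map-∘ {g = φ} {f = u} (allFin (2 * n))))))

  n+n : n + n ≡ suc k
  n+n = cong (n +_) (sym (+-identityʳ n))

  m+sn : m + suc n ≡ suc k
  m+sn = trans (+-suc m n) n+n

  -- Two half turns are a full period. This makes the antipode of v i adjacent to the far end of the
  -- backward arm too.
  half-turn : ∀ i → prev^ n i ≡ next^ n i
  half-turn i = trans (cong (prev^ n) (sym (trans (sym (iter-+ next n n i))
    (trans (cong (λ l → next^ l i) n+n) (next^-period i))))) (prev^-next^ n (next^ n i))

  -- The target, its antipode and two arms with n path vertices and m pendants each list every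
  -- vertex once.
  sum-from-v : ∀ φ i → sum (map φ (MiddleCycle.all (2 * n))) ≡
    φ (v i) + (φ (v (next^ n i)) +
      (zigzag (λ j → φ (u (next^ j i))) (λ j → φ (v (next^ (suc j) i))) m +
       zigzag (λ j → φ (u (prev^ (suc j) i))) (λ j → φ (v (prev^ (suc j) i))) m))
  sum-from-v φ i = begin
    sum (map φ (MiddleCycle.all (2 * n)))
      ≡⟨ sum-all φ ⟩
    sum (map (φ ∘ v) (allFin (2 * n))) + sum (map (φ ∘ u) (allFin (2 * n)))
      ≡⟨ cong₂ _+_ (around (suc n) m m+sn (φ ∘ v) i) (around n n n+n (φ ∘ u) i) ⟩
    (Σ< V n + V n) + V⁻ + (U + U⁻)
      ≡⟨ cong (λ s → (s + V n) + V⁻ + (U + U⁻)) (Σ<-head V m) ⟩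
    (V 0 + Σ< (V ∘ suc) m + V n) + V⁻ + (U + U⁻)
      ≡⟨ regroup (V 0) (Σ< (V ∘ suc) m) (V n) V⁻ U U⁻ ⟩
    V 0 + (V n + ((U + Σ< (V ∘ suc) m) + (U⁻ + V⁻)))
      ≡⟨ cong₂ (λ s t → V 0 + (V n + (s + t))) (zigzag-Σ (λ j → φ (u (next^ j i))) (V ∘ suc) m)
           (zigzag-Σ (λ j → φ (u (prev^ (suc j) i))) (λ j → φ (v (prev^ (suc j) i))) m) ⟨
    _ ∎
    where
    open ≡-Reasoning
    V : ℕ → ℕ
    V j = φ (v (next^ j i))
    V⁻ U U⁻ : ℕ
    V⁻ = Σ< (λ j → φ (v (prev^ (suc j) i))) m
    U  = Σ< (λ j → φ (u (next^ j i))) n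
    U⁻ = Σ< (λ j → φ (u (prev^ (suc j) i))) n
    regroup : ∀ a b c d e f → (a + b + c) + d + (e + f) ≡ a + (c + ((e + b) + (f + d)))
    regroup = solve-∀

  -- Both arms start at u i, which counts in the forward arm only, hence `U⁻ 0 ≡ 0`; the forward arm
  -- is one level longer.
  sum-from-u : ∀ φ i (U⁻ : ℕ → ℕ) → U⁻ 0 ≡ 0 → (∀ j → U⁻ (suc j) ≡ φ (u (prev^ (suc j) i))) →
    sum (map φ (MiddleCycle.all (2 * n))) ≡
    zigzag (λ j → φ (u (next^ j i))) (λ j → φ (v (next^ (suc j) i))) n +
      (φ (v (prev^ m i)) + zigzag U⁻ (λ j → φ (v (prev^ j i))) m)
  sum-from-u φ i U⁻ U⁻0 U⁻suc = begin
    sum (map φ (MiddleCycle.all (2 * n)))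
      ≡⟨ sum-all φ ⟩
    sum (map (φ ∘ v) (allFin (2 * n))) + sum (map (φ ∘ u) (allFin (2 * n)))
      ≡⟨ cong₂ _+_ (around (suc n) m m+sn (φ ∘ v) i) (around (suc n) m m+sn (φ ∘ u) i) ⟩
    Σ< V (suc n) + Σ< (V⁻ ∘ suc) m + (U + Σ< (λ j → φ (u (prev^ (suc j) i))) m)
      ≡⟨ cong₂ (λ s t → s + Σ< (V⁻ ∘ suc) m + (U + t)) (Σ<-head V n)
           (trans (sym (Σ<-cong U⁻suc m)) (sym (trans (Σ<-head U⁻ m) (cong (_+ Σ< (U⁻ ∘ suc) m) U⁻0)))) ⟩
    V⁻ 0 + Σ< (V ∘ suc) n + Σ< (V⁻ ∘ suc) m + (U + Σ< U⁻ (suc m))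
      ≡⟨ regroup (V⁻ 0) (Σ< (V ∘ suc) n) (Σ< (V⁻ ∘ suc) m) U (Σ< U⁻ (suc m)) ⟩
    (U + Σ< (V ∘ suc) n) + (V⁻ 0 + Σ< (V⁻ ∘ suc) m + Σ< U⁻ (suc m))
      ≡⟨ cong (λ s → (U + Σ< (V ∘ suc) n) + (s + Σ< U⁻ (suc m))) (Σ<-head V⁻ m) ⟨
    (U + Σ< (V ∘ suc) n) + (Σ< V⁻ m + V⁻ m + Σ< U⁻ (suc m))
      ≡⟨ cong ((U + Σ< (V ∘ suc) n) +_) (swap (Σ< V⁻ m) (V⁻ m) (Σ< U⁻ (suc m))) ⟩
    (U + Σ< (V ∘ suc) n) + (V⁻ m + (Σ< U⁻ (suc m) + Σ< V⁻ m))
      ≡⟨ cong₂ (λ s t → s + (V⁻ m + t)) (zigzag-Σ (λ j → φ (u (next^ j i))) (V ∘ suc) n) (zigzag-Σ U⁻ V⁻ m) ⟨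
    _ ∎
    where
    open ≡-Reasoning
    V V⁻ : ℕ → ℕ
    V j  = φ (v (next^ j i))
    V⁻ j = φ (v (prev^ j i))
    U : ℕ
    U = Σ< (λ j → φ (u (next^ j i))) (suc n)
    regroup : ∀ a b c d e → a + b + c + (d + e) ≡ (d + b) + (a + c + e)
    regroup = solve-∀
    swap : ∀ a b c → a + b + c ≡ b + (c + a)
    swap = solve-∀

-- Distributions on a product as sums of loaded copies.

module Slices (K G : Graph) (F : ℕ) (suffices : Suffices G F)
  (oddTwo : ∀ D → 2 * F < size G D + oddCount G D → ∀ y → CanPlace G 2 y D)
  (y : Graph.V G) where

  private
    module K = Graph K
    module G = Graph G
  open Columns K G F suffices oddTwo y

  slice : Distribution (K □ G) → K.V → Distribution G
  slice D a x = D (a , x)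

  size-slices : ∀ D → size (K □ G) D ≡ sum (map (λ a → size G (slice D a)) K.vertices)
  size-slices D = go K.vertices
    where
    go : ∀ (as : List K.V) → sum (map D (cartesianProduct as G.vertices)) ≡
      sum (map (λ a → size G (slice D a)) as)
    go [] = refl
    go (a ∷ as) = trans (cong sum (map-++ D (map (a ,_) G.vertices) (cartesianProduct as G.vertices)))
      (trans (sum-++ (map D (map (a ,_) G.vertices)) (map D (cartesianProduct as G.vertices)))
        (cong₂ _+_ (cong sum (sym (map-∘ {g = D} {f = a ,_} G.vertices))) (go as)))

  point-slices : ∀ D z → sum (map (λ a → column a (slice D a) z) K.vertices) ≡ D z
  point-slices D (b , x) = trans
    (Existence.sum-change K {D = ∅} {E = λ a → column a (slice D a) (b , x)} {u = b} {c = D (b , x)}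
      K.vertices K.unique (K.complete b)
      (trans (column-same b (slice D b) x) (sym (+-identityʳ _)))
      (λ a a≢b → column-other (slice D a) x a≢b))
    (trans (cong (D (b , x) +_) (Pebbling.size-∅ K)) (+-identityʳ _))

  module _ (A : Arm K) (X W : ℕ → Distribution G) where
    open Arm A
    open Load A X W

    weight-zigzag : ∀ j → weight j (X j) ≡ zigzag (size G ∘ X) (size G ∘ W) j
    weight-zigzag zero    = refl
    weight-zigzag (suc j) = cong (λ k → size G (X (suc j)) + (size G (W j) + k)) (weight-zigzag j)

    point-zigzag : ∀ z j → ⟦ caterpillar j (X j) ⟧ z ≡
      zigzag (λ j → column (path j) (X j) z) (λ j → column (pendant j) (W j) z) j
    point-zigzag z zero    = refl
    point-zigzag z (suc j) = cong (λ k → column (path (suc j)) (X (suc j)) z + (column (pendant j) (W j) z + k))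
      (point-zigzag z j)

-- The claimed value of f(M(C_2n)), not its number of vertices.
order : ℕ → ℕ
order n = 2 ^ (n + 1) + 2 * n ∸ 2

-- By `cost-closed` the inner factor is `cost 2 m + 2`, the share of each of two arms.
order-suc : ∀ m → order (suc m) ≡ 2 * (2 * 2 ^ m + m)
order-suc m = trans (cong (_∸ 2) (trans (cong (λ k → 2 * 2 ^ k + 2 * suc m) (+-comm m 1)) (eq (2 ^ m) m)))
  (m+n∸n≡m (2 * (2 * 2 ^ m + m)) 2)
  where
  eq : ∀ p m → 2 * (2 * p) + 2 * (1 + m) ≡ 2 * (2 * p + m) + 2
  eq = solve-∀

-- The upper bound for the product with the middle graph.

module MiddleProduct (m : ℕ) (2≤n : 2 ≤ suc (suc m)) where

  open MiddleSum (suc m) using (n; half-turn; sum-from-v; sum-from-u)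
  open Rotation (suc m + (suc (suc m) + 0))

  K : Graph
  K = M[C₂ₙ] (suc (suc m)) 2≤n

  I : Set
  I = Fin (2 * suc (suc m))

  forward : I → Arm K
  forward i = record
    { path         = λ j → u (next^ j i)
    ; pendant      = λ j → v (next^ (suc j) i)
    ; path-adj     = λ j → bwd (u—u⁺ refl)
    ; pendant-adj  = λ j → bwd (u—v⁺ refl)
    ; pendant-adj⁺ = λ j → fwd (v—u refl)
    }

  backward : I → Arm K
  backward i = record
    { path         = λ j → u (prev^ j i)
    ; pendant      = λ j → v (prev^ j i)
    ; path-adj     = λ j → fwd (u—u⁺ (sym (next-prev (prev^ j i))))
    ; pendant-adj  = λ j → fwd (v—u refl)
    ; pendant-adj⁺ = λ j → bwd (u—v⁺ (sym (next-prev (prev^ j i))))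
    }

  -- For the target v i: the arm starts one step back, at the other neighbour of v i.
  backward′ : I → Arm K
  backward′ i = record
    { path         = λ j → u (prev^ (suc j) i)
    ; pendant      = λ j → v (prev^ (suc j) i)
    ; path-adj     = λ j → path-adj (suc j)
    ; pendant-adj  = λ j → pendant-adj (suc j)
    ; pendant-adj⁺ = λ j → pendant-adj⁺ (suc j)
    }
    where open Arm (backward i)

  module _ (G : Graph) (F : ℕ) (suffices : Suffices G F)
    (oddTwo : ∀ D → 2 * F < size G D + oddCount G D → ∀ y → CanPlace G 2 y D) where

    module _ (D : Distribution (K □ G)) (sizeD : size (K □ G) D ≡ order n * F) (y : Graph.V G) where

      open Columns K G F suffices oddTwo y
      open Slices K G F suffices oddTwo y
      open Pebbling (K □ G) using (_⟶_; forget) renaming (_⨾_ to _⨟_; ⟶⇒canPlace to toCanPlace)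

      conclude : ∀ {Ω} t → (∀ z → D z ≡ ⟦ Ω ⟧ z) → Ω ⇒ col t (Pebbling.pt G y 1) → CanPlace (K □ G) 1 (t , y) D
      conclude t eq (run p) = toCanPlace
        (forget (λ z → ≤-reflexive (sym (eq z))) ⨟ p ⨟ forget λ z → ≤-reflexive (sym (column-pt t y 1 z)))

      reach-v : ∀ i → CanPlace (K □ G) 1 (v i , y) D
      reach-v i = conclude (v i) points
        (solve-twoArms A B (v (next^ n i)) m (bwd (u—v⁺ refl)) (fwd (v—u (half-turn i)))
          (slice D (v i)) (slice D (v (next^ n i))) enough)
        where
        open VertexTarget K G F suffices oddTwo y (v i)
        A B : RootedArm
        A = record { arm = forward i ; root = bwd (v—u refl)
                   ; pathLoad = λ j → slice D (u (next^ j i)) ; pendLoad = λ j → slice D (v (next^ (suc j) i)) }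
        B = record { arm = backward′ i ; root = fwd (u—v⁺ (sym (next-prev i)))
                   ; pathLoad = λ j → slice D (u (prev^ (suc j) i)) ; pendLoad = λ j → slice D (v (prev^ (suc j) i)) }
        module A = RootedArm A
        module B = RootedArm B
        points : ∀ z → D z ≡ ⟦ col (v i) (slice D (v i)) ∙ (col (v (next^ n i)) (slice D (v (next^ n i))) ∙
          (A.caterpillar (suc m) (A.pathLoad (suc m)) ∙ B.caterpillar (suc m) (B.pathLoad (suc m)))) ⟧ z
        points z = trans (sym (point-slices D z)) (trans (sum-from-v (λ a → column a (slice D a) z) i)
          (cong₂ (λ s t → column (v i) (slice D (v i)) z + (column (v (next^ n i)) (slice D (v (next^ n i))) z + (s + t)))
            (sym (point-zigzag A.arm A.pathLoad A.pendLoad z (suc m)))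
            (sym (point-zigzag B.arm B.pathLoad B.pendLoad z (suc m)))))
        enough : 2 * ((cost 2 (suc m) + 2) * F) ≤
          size G (slice D (v i)) + (size G (slice D (v (next^ n i))) + (A.load (suc m) + B.load (suc m)))
        enough = ≤-reflexive (begin
          2 * ((cost 2 (suc m) + 2) * F)          ≡⟨ cong (λ k → 2 * (k * F)) (cost-closed 2 (suc m)) ⟩
          2 * ((2 * 2 ^ suc m + suc m) * F)       ≡⟨ *-assoc 2 (2 * 2 ^ suc m + suc m) F ⟨
          2 * (2 * 2 ^ suc m + suc m) * F         ≡⟨ cong (_* F) (order-suc (suc m)) ⟨
          order n * F                             ≡⟨ sizeD ⟨
          size (K □ G) D                          ≡⟨ size-slices D ⟩
          sum (map (λ a → size G (slice D a)) (Graph.vertices K))  ≡⟨ sum-from-v (λ a → size G (slice D a)) i ⟩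
          _                                       ≡⟨ cong₂ (λ s t → size G (slice D (v i)) + (size G (slice D (v (next^ n i))) + (s + t)))
                                                       (sym (weight-zigzag A.arm A.pathLoad A.pendLoad (suc m)))
                                                       (sym (weight-zigzag B.arm B.pathLoad B.pendLoad (suc m))) ⟩
          _                                       ∎)
          where open ≡-Reasoning

      reach-u : ∀ i → CanPlace (K □ G) 1 (u i , y) D
      reach-u i = conclude (u i) points (solve-inner enough)
        where
        XA WA XB WB : ℕ → Distribution G
        XA j = slice D (u (next^ j i))
        WA j = slice D (v (next^ (suc j) i))
        XB zero    = ∅  -- the column of u i is counted in XA
        XB (suc j) = slice D (u (prev^ (suc j) i))
        WB j = slice D (v (prev^ j i))
        z₀ : MiddleVertex (2 * suc (suc m))
        z₀ = v (prev^ (suc m) i)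
        open VertexTarget K G F suffices oddTwo y (u i) using (module InnerTarget)
        open InnerTarget (forward i) (backward i) XA WA XB WB refl refl (suc m) z₀ (fwd (v—u refl)) (slice D z₀)
        points : ∀ z → D z ≡ ⟦ Ω ⟧ z
        points z = trans (sym (point-slices D z)) (trans
          (sum-from-u (λ a → column a (slice D a) z) i (λ j → column (u (prev^ j i)) (XB j) z)
            (column-∅ (u i) z) (λ _ → refl))
          (cong₂ (λ s t → s + (column z₀ (slice D z₀) z + t))
            (sym (point-zigzag (forward i) XA WA z n)) (sym (point-zigzag (backward i) XB WB z (suc m)))))
        enough : (cost 1 n + 2 ^ suc m + cost 1 (suc m) + 1) * F ≤ total
        enough = ≤-reflexive (begin
          (cost 1 n + 2 ^ suc m + cost 1 (suc m) + 1) * F   ≡⟨ cong (_* F) (split (2 ^ suc m) (cost 1 (suc m))) ⟩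
          (2 * 2 ^ suc m + 2 * (cost 1 (suc m) + 1)) * F    ≡⟨ cong (λ c → (2 * 2 ^ suc m + 2 * c) * F) (cost-closed 1 (suc m)) ⟩
          (2 * 2 ^ suc m + 2 * (1 * 2 ^ suc m + suc m)) * F ≡⟨ cong (_* F) (twice (2 ^ suc m) (suc m)) ⟩
          2 * (2 * 2 ^ suc m + suc m) * F         ≡⟨ cong (_* F) (order-suc (suc m)) ⟨
          order n * F                             ≡⟨ sizeD ⟨
          size (K □ G) D                          ≡⟨ size-slices D ⟩
          sum (map (λ a → size G (slice D a)) (Graph.vertices K))
            ≡⟨ sum-from-u (λ a → size G (slice D a)) i (λ j → size G (XB j)) (Pebbling.size-∅ G) (λ _ → refl) ⟩
          _ ≡⟨ cong₂ (λ s t → s + (size G (slice D z₀) + t))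
                 (sym (weight-zigzag (forward i) XA WA n)) (sym (weight-zigzag (backward i) XB WB (suc m))) ⟩
          _                                       ∎)
          where
          open ≡-Reasoning
          split : ∀ p c → (1 + 1 * p + c) + p + c + 1 ≡ 2 * p + 2 * (c + 1)
          split = solve-∀
          twice : ∀ p s → 2 * p + 2 * (1 * p + s) ≡ 2 * (2 * p + s)
          twice = solve-∀

    suffices-product : Suffices (K □ G) (order n * F)
    suffices-product D sizeD (v i , y) = reach-v D sizeD y i
    suffices-product D sizeD (u i , y) = reach-u D sizeD y i

-- The lower bound, by a weight function that no move increases.

module Potential (Γ : Graph) (φ : Graph.V Γ → ℕ → ℕ) (release intake : Graph.V Γ → ℕ)
  (φ-release : ∀ x a → φ x (2 + a) ≡ release x + φ x a)
  (φ-mono    : ∀ x a → φ x a ≤ φ x (1 + a))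
  (φ-intake  : ∀ x a → φ x (1 + a) ≤ intake x + φ x a)
  (φ-edge    : ∀ {x y} → Graph.Adj Γ x y → intake y ≤ release x) where

  open Graph Γ
  open Existence Γ using (upd; upd-same; upd-other; sum-change; adj⇒≢)

  Φ : Distribution Γ → ℕ
  Φ D = size Γ (λ x → φ x (D x))

  -- A move passes through `D₀`, where the pair is gone and the new pebble not yet placed. The
  -- weight freed at the source covers the gain at the target by `φ-edge`.
  Φ-move : ∀ {D D′} → Move Γ D D′ → Φ D′ ≤ Φ D
  Φ-move {D} {D′} (move {s} {t} e r p o) = begin
    Φ D′              ≡⟨ sum-change {D = λ x → φ x (D₀ x)} {E = λ x → φ x (D′ x)} vertices unique (complete t) arrive arrive-other ⟩
    c + Φ D₀          ≤⟨ +-monoˡ-≤ (Φ D₀) c≤ ⟩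
    release s + Φ D₀  ≡⟨ sum-change {D = λ x → φ x (D₀ x)} {E = λ x → φ x (D x)} vertices unique (complete s) leave leave-other ⟨
    Φ D               ∎
    where
    open ≤-Reasoning
    D₀ : Distribution Γ
    D₀ = upd s (D′ s) D
    -- `sum-change` needs the exact gain, whereas `φ-intake` only bounds it.
    c : ℕ
    c = φ t (1 + D t) ∸ φ t (D t)
    c≤ : c ≤ release s
    c≤ = ≤-trans (m≤n+o⇒m∸n≤o (φ t (1 + D t)) (φ t (D t)) (≤-trans (φ-intake t (D t)) (≤-reflexive (+-comm (intake t) _)))) (φ-edge e)
    arrive : φ t (D′ t) ≡ c + φ t (D₀ t)
    arrive = trans (cong (φ t) p) (trans (sym (m∸n+n≡m (φ-mono t (D t))))
      (cong (λ k → c + φ t k) (sym (upd-other s (D′ s) D t (adj⇒≢ e ∘ sym)))))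
    arrive-other : ∀ w → w ≢ t → φ w (D′ w) ≡ φ w (D₀ w)
    arrive-other w w≢t with w ≟ s
    ... | yes refl = refl
    ... | no w≢s   = cong (φ w) (o w w≢s w≢t)
    leave : φ s (D s) ≡ release s + φ s (D₀ s)
    leave = trans (cong (φ s) r) (trans (φ-release s (D′ s))
      (cong (λ k → release s + φ s k) (sym (upd-same s (D′ s) D))))
    leave-other : ∀ w → w ≢ s → φ w (D w) ≡ φ w (D₀ w)
    leave-other w w≢s = cong (φ w) (sym (upd-other s (D′ s) D w w≢s))

  Φ-moves : ∀ {D D′} → Star (Move Γ) D D′ → Φ D′ ≤ Φ D
  Φ-moves ε        = ≤-refl
  Φ-moves (m ◅ ms) = ≤-trans (Φ-moves ms) (Φ-move m)

  unreachable : ∀ {D t} → Φ D < φ t 1 → (∀ {k} → 1 ≤ k → φ t 1 ≤ φ t k) → ¬ CanPlace Γ 1 t D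
  unreachable {t = t} Φ< φ≥ (D′ , ms , 1≤) = <⇒≱ Φ<
    (≤-trans (φ≥ 1≤) (≤-trans (Existence.term≤sum Γ (complete t)) (Φ-moves ms)))

module LowerBound (m : ℕ) (2≤n : 2 ≤ suc m) where
  open MiddleSum m using (n; k; sum-all)

  K : Graph
  K = M[C₂ₙ] (suc m) 2≤n

  -- The target is v 0.  A pebble on u i has weight 2 ^ eu i, a pair of pebbles
  -- on v i with i ≠ 0 weight 2 ^ ev i, where ev i = |n − i|; a single pebble
  -- there weighs nothing, because the neighbours of v i are adjacent.
  ev eu : ℕ → ℕ
  ev i = (n ∸ i) + (i ∸ n)
  eu i = (n ∸ suc i) + (i ∸ n)

  ∸-suc-lower : ∀ a i → a ∸ suc i ≤ a ∸ i
  ∸-suc-lower a i = ∸-monoʳ-≤ a (n≤1+n i)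

  ∸-suc-upper : ∀ a i → a ∸ i ≤ suc (a ∸ suc i)
  ∸-suc-upper zero    zero    = z≤n
  ∸-suc-upper zero    (suc i) = z≤n
  ∸-suc-upper (suc a) zero    = ≤-refl
  ∸-suc-upper (suc a) (suc i) = ∸-suc-upper a i

  suc-∸-upper : ∀ i a → suc i ∸ a ≤ suc (i ∸ a)
  suc-∸-upper i       zero          = ≤-refl
  suc-∸-upper zero    (suc a)       = ≤-trans (≤-reflexive (0∸n≡0 a)) z≤n
  suc-∸-upper (suc i) (suc a)       = suc-∸-upper i a

  eu≤ev : ∀ i → eu i ≤ ev i
  eu≤ev i = +-monoˡ-≤ (i ∸ n) (∸-suc-lower n i)

  ev≤1+eu : ∀ i → ev i ≤ suc (eu i)
  ev≤1+eu i = +-monoˡ-≤ (i ∸ n) (∸-suc-upper n i)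

  eu≤ev⁺ : ∀ i → eu i ≤ ev (suc i)
  eu≤ev⁺ i = +-monoʳ-≤ (n ∸ suc i) (∸-monoˡ-≤ n (n≤1+n i))

  ev⁺≤1+eu : ∀ i → ev (suc i) ≤ suc (eu i)
  ev⁺≤1+eu i = ≤-trans (+-monoʳ-≤ (n ∸ suc i) (suc-∸-upper i n)) (≤-reflexive (+-suc (n ∸ suc i) (i ∸ n)))

  -- At the seam, where `next` returns to 0, both sides equal n.
  ev-next : ∀ (i : Fin (suc k)) → ev (toℕ (next i)) ≡ ev (suc (toℕ i))
  ev-next i with <-cmp (suc (toℕ i)) (suc k)
  ... | tri< lt _ _ = cong ev (trans (MiddleCycle.toℕ-next 0 i) (m<n⇒m%n≡m lt))
  ... | tri> _ _ gt = contradiction (Fin.toℕ<n i) (<⇒≱ gt)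
  ... | tri≈ _ eq _ = trans (cong ev (trans (MiddleCycle.toℕ-next 0 i) (trans (cong (_% suc k) eq) (n%n≡0 (suc k)))))
        (trans ev-wrap (cong ev (sym eq)))
    where
    ev-wrap : ev 0 ≡ ev (suc k)
    ev-wrap = trans (+-identityʳ n) (sym (trans
      (cong₂ _+_ (m≤n⇒m∸n≡0 (m≤m+n n (n + 0))) (m+n∸m≡n n (n + 0))) (+-identityʳ n)))

  I : Set
  I = Fin (suc k)

  -- The target is the only vertex of the cycle on which single pebbles count, with weight 2ⁿ each.
  φ : MiddleVertex (suc k) → ℕ → ℕ
  φ (v zero)        a = 2 ^ ev 0 * a
  φ (v i@(suc _))   a = 2 ^ ev (toℕ i) * ⌊ a /2⌋
  φ (u i)           a = 2 ^ eu (toℕ i) * a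

  release intake : MiddleVertex (suc k) → ℕ
  release (v zero)      = 2 * 2 ^ ev 0
  release (v i@(suc _)) = 2 ^ ev (toℕ i)
  release (u i)         = 2 * 2 ^ eu (toℕ i)
  intake (v i) = 2 ^ ev (toℕ i)
  intake (u i) = 2 ^ eu (toℕ i)

  two-more : ∀ w a → w * (2 + a) ≡ 2 * w + w * a
  two-more = solve-∀

  φ-release : ∀ x a → φ x (2 + a) ≡ release x + φ x a
  φ-release (v zero)      a = two-more (2 ^ ev 0) a
  φ-release (v i@(suc _)) a = *-suc (2 ^ ev (toℕ i)) ⌊ a /2⌋
  φ-release (u i)         a = two-more (2 ^ eu (toℕ i)) a

  φ-mono : ∀ x a → φ x a ≤ φ x (1 + a)
  φ-mono (v zero)      a = *-monoʳ-≤ (2 ^ ev 0) (n≤1+n a)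
  φ-mono (v i@(suc _)) a = *-monoʳ-≤ (2 ^ ev (toℕ i)) (⌊n/2⌋-mono (n≤1+n a))
  φ-mono (u i)         a = *-monoʳ-≤ (2 ^ eu (toℕ i)) (n≤1+n a)

  φ-intake : ∀ x a → φ x (1 + a) ≤ intake x + φ x a
  φ-intake (v zero)      a = ≤-reflexive (*-suc (2 ^ ev 0) a)
  φ-intake (v i@(suc _)) a = ≤-trans (*-monoʳ-≤ (2 ^ ev (toℕ i)) (⌊n/2⌋-mono (n≤1+n (suc a))))
                                     (≤-reflexive (*-suc (2 ^ ev (toℕ i)) ⌊ a /2⌋))
  φ-intake (u i)         a = ≤-reflexive (*-suc (2 ^ eu (toℕ i)) a)

  2^-mono : ∀ {a b} → a ≤ b → 2 ^ a ≤ 2 ^ b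
  2^-mono = ^-monoʳ-≤ 2

  release-v : ∀ i → 2 ^ ev (toℕ i) ≤ release (v i)
  release-v zero    = m≤m+n (2 ^ ev 0) (2 ^ ev 0 + 0)
  release-v (suc i) = ≤-refl

  -- A pair on u i weighs twice 2 ^ eu i, and the exponent grows by at most one along an edge. From
  -- v i to a neighbour it does not grow, so the single weight of a pair there suffices.
  φ-edge : ∀ {x y} → Graph.Adj K x y → intake y ≤ release x
  φ-edge (fwd (v—u {i} refl)) = ≤-trans (2^-mono (eu≤ev (toℕ i))) (release-v i)
  φ-edge (bwd (v—u {i} refl)) = 2^-mono (ev≤1+eu (toℕ i))
  φ-edge (fwd (u—v⁺ {i} refl)) = 2^-mono (≤-trans (≤-reflexive (ev-next i)) (ev⁺≤1+eu (toℕ i)))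
  φ-edge (bwd (u—v⁺ {i} refl)) = ≤-trans (2^-mono (≤-trans (eu≤ev⁺ (toℕ i)) (≤-reflexive (sym (ev-next i))))) (release-v (next i))
  φ-edge (fwd (u—u⁺ {i} refl)) = 2^-mono (≤-trans (eu≤ev (toℕ (next i)))
    (≤-trans (≤-reflexive (ev-next i)) (ev⁺≤1+eu (toℕ i))))
  φ-edge (bwd (u—u⁺ {i} refl)) = 2^-mono (≤-trans (eu≤ev⁺ (toℕ i))
    (≤-trans (≤-reflexive (sym (ev-next i))) (ev≤1+eu (toℕ (next i)))))

  open Potential K φ release intake φ-release φ-mono φ-intake φ-edge
  open Existence K using (upd; upd-same; upd-other; sum-change)

  m<k : m < k
  m<k = ≤-trans (≤-reflexive (+-comm 1 m)) (+-monoʳ-≤ m (s≤s z≤n))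

  antipode : I
  antipode = suc (fromℕ< m<k)

  toℕ-antipode : toℕ antipode ≡ n
  toℕ-antipode = cong suc (Fin.toℕ-fromℕ< m<k)

  ev-antipode : ev (toℕ antipode) ≡ 0
  ev-antipode = trans (cong ev toℕ-antipode) (cong₂ _+_ (n∸n≡0 n) (n∸n≡0 n))

  p : ℕ
  p = proj₁ (m≤n⇒∃[o]m+o≡n (m^n>0 2 n))

  1+p : 1 + p ≡ 2 ^ n
  1+p = proj₂ (m≤n⇒∃[o]m+o≡n (m^n>0 2 n))

  ones base extremal : Distribution K
  ones (v _) = 1
  ones (u _) = 0
  base (v zero)    = 0
  base (v (suc _)) = 1
  base (u _)       = 0
  -- Here p = 2ⁿ − 1, so the antipode carries 2ⁿ⁺¹ − 1 pebbles.
  extremal = upd (v antipode) (suc (p + p)) base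

  size-ones : size K ones ≡ 2 * n
  size-ones = trans (sum-all ones) (trans (cong₂ _+_
    (sum-allFin (2 * n) (λ _ → 1) (λ _ → 1) (λ _ → refl))
    (sum-allFin (2 * n) (λ _ → 0) (λ _ → 0) (λ _ → refl)))
    (trans (cong₂ _+_ (Σ<-1 (2 * n)) (Σ<-0 (2 * n))) (+-identityʳ (2 * n))))
    where
    Σ<-1 : ∀ b → Σ< (λ _ → 1) b ≡ b
    Σ<-1 zero    = refl
    Σ<-1 (suc b) = trans (cong (_+ 1) (Σ<-1 b)) (+-comm b 1)
    Σ<-0 : ∀ b → Σ< (λ _ → 0) b ≡ 0
    Σ<-0 zero    = refl
    Σ<-0 (suc b) = trans (+-identityʳ _) (Σ<-0 b)

  size-base : 1 + size K base ≡ 2 * n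
  size-base = trans (sym (sum-change {D = base} {E = ones} {u = v zero} {c = 1} (Graph.vertices K) (Graph.unique K)
    (Graph.complete K (v zero)) refl agree)) size-ones
    where
    agree : ∀ w → w ≢ v zero → ones w ≡ base w
    agree (v zero)    ≢v = contradiction refl ≢v
    agree (v (suc _)) _  = refl
    agree (u _)       _  = refl

  size-extremal : suc (size K extremal) ≡ order n
  size-extremal = begin
    suc (size K extremal)         ≡⟨ cong suc (sum-change {D = base} {E = extremal} {u = v antipode} {c = p + p}
                                       (Graph.vertices K) (Graph.unique K) (Graph.complete K (v antipode))
                                       (trans (upd-same (v antipode) (suc (p + p)) base) (+-comm 1 (p + p)))
                                       (upd-other (v antipode) (suc (p + p)) base)) ⟩
    suc ((p + p) + size K base)   ≡⟨ +-suc (p + p) (size K base) ⟨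
    (p + p) + (1 + size K base)   ≡⟨ cong ((p + p) +_) size-base ⟩
    (p + p) + 2 * n               ≡⟨ m+n∸n≡m ((p + p) + 2 * n) 2 ⟨
    (p + p) + 2 * n + 2 ∸ 2       ≡⟨ cong (_∸ 2) (trans (collect p (2 * n)) (cong (λ k → 2 * k + 2 * n) 1+p)) ⟩
    2 * 2 ^ n + 2 * n ∸ 2         ≡⟨ cong (λ k → 2 ^ k + 2 * n ∸ 2) (+-comm 1 n) ⟩
    order n                       ∎
    where
    open ≡-Reasoning
    collect : ∀ p s → (p + p) + s + 2 ≡ 2 * (1 + p) + s
    collect = solve-∀

  -- Only the p pairs on the antipode count, with weight 2⁰ each; the single pebbles elsewhere weigh
  -- nothing.
  Φ-extremal : Φ extremal ≡ p
  Φ-extremal = trans (sum-change {D = ∅} {E = λ x → φ x (extremal x)} {u = v antipode} {c = p}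
      (Graph.vertices K) (Graph.unique K) (Graph.complete K (v antipode)) peak elsewhere)
    (trans (cong (p +_) (Pebbling.size-∅ K)) (+-identityʳ p))
    where
    peak : φ (v antipode) (extremal (v antipode)) ≡ p + 0
    peak = trans (cong (φ (v antipode)) (upd-same (v antipode) (suc (p + p)) base))
      -- `⌊ suc (p + p) /2⌋` is by definition `⌈ p + p /2⌉`, which equals p.
      (cong₂ (λ e h → 2 ^ e * h) ev-antipode (sym (n≡⌈n+n/2⌉ p)))
    φ-base : ∀ x → φ x (base x) ≡ 0
    φ-base (v zero)      = *-zeroʳ (2 ^ ev 0)
    φ-base (v i@(suc _)) = *-zeroʳ (2 ^ ev (toℕ i))
    φ-base (u i)         = *-zeroʳ (2 ^ eu (toℕ i))
    elsewhere : ∀ w → w ≢ v antipode → φ w (extremal w) ≡ 0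
    elsewhere w ≢v = trans (cong (φ w) (upd-other (v antipode) (suc (p + p)) base w ≢v)) (φ-base w)

  ev-0 : ev 0 ≡ n
  ev-0 = +-identityʳ n

  -- The extremal distribution has weight 2ⁿ - 1, less than one pebble on the target; smaller values
  -- of q are excluded by `suffices-mono`.
  order≤-suffices : ∀ q → Suffices K q → order n ≤ q
  order≤-suffices q suff with order n ≤? q
  ... | yes ≤q = ≤q
  ... | no ≰q  = ⊥-elim (unreachable {extremal} {v zero} small (λ 1≤k → *-monoʳ-≤ (2 ^ ev 0) 1≤k)
        (Pebbling.suffices-mono K (≤-pred (≤-trans (≰⇒> ≰q) (≤-reflexive (sym size-extremal)))) suff extremal refl (v zero)))
    where
    small : Φ extremal < φ (v zero) 1
    small = ≤-reflexive (trans (cong suc Φ-extremal) (trans 1+p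
      (trans (cong (2 ^_) (sym ev-0)) (sym (*-identityʳ (2 ^ ev 0))))))

-- The factor K_1 and the value of f(M(C_2n)).

single : Graph
single = record
  { V = ⊤ ; _≟_ = λ _ _ → yes refl
  ; vertices = tt ∷ [] ; unique = [] ∷ [] ; complete = λ _ → here refl
  ; Adj = λ _ _ → ⊥ ; adj? = λ _ _ → no id ; symmetric = id ; loopless = id
  ; connected = λ _ _ → ε }

single-suffices : Suffices single 1
single-suffices D eq tt = D , ε , ≤-reflexive (sym (trans (sym (+-identityʳ (D tt))) eq))

-- At most one vertex is odd, so p + r > 2 already means that two pebbles lie on the only vertex.
single-oddTwo : ∀ D → 2 < size single D + oddCount single D → ∀ y → CanPlace single 2 y D
single-oddTwo D lt tt = D , ε , ≤-pred (≤-trans lt (≤-trans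
  (+-monoʳ-≤ (size single D) (length-filter (λ x → ¬? (2 ∣? D x)) (tt ∷ [])))
  (≤-reflexive (trans (+-comm (D tt + 0) 1) (cong suc (+-identityʳ (D tt)))))))

-- K_1 has no edges, so every move in the product is a move of K.
□-single : ∀ K {p} → Suffices (K □ single) p → Suffices K p
□-single K suff D eq a = let E , ms , 1≤ = suff (D ∘ proj₁) (trans (go (Graph.vertices K)) eq) (a , tt) in
  E ∘ (_, tt) , Star.gmap (_∘ (_, tt)) project ms , 1≤
  where
  go : ∀ as → sum (map (D ∘ proj₁) (cartesianProduct as (tt ∷ []))) ≡ sum (map D as)
  go []       = refl
  go (a ∷ as) = cong (D a +_) (go as)
  project : ∀ {E E′} → Move (K □ single) E E′ → Move K (E ∘ (_, tt)) (E′ ∘ (_, tt))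
  project (move (inj₁ (e , _)) r p o) =
    move e r p (λ w ≢s ≢t → o (w , tt) (≢s ∘ cong proj₁) (≢t ∘ cong proj₁))

f-middle : ∀ m (2≤n : 2 ≤ suc (suc m)) → f (M[C₂ₙ] (suc (suc m)) 2≤n) ≡ order (suc (suc m))
f-middle m 2≤n = ≤-antisym
  (proj₂ (f-isPebblingNumber K) (order n) (□-single K (subst (Suffices (K □ single)) (*-identityʳ (order n))
    (suffices-product single 1 single-suffices single-oddTwo))))
  (LowerBound.order≤-suffices (suc m) 2≤n (f K) (proj₁ (f-isPebblingNumber K)))
  where
  open MiddleProduct m 2≤n using (K; suffices-product)
  n : ℕ
  n = suc (suc m)

theorem3p8 : (n : ℕ) (2≤n : 2 ≤ n) (G : Graph) → OddTwoPebbling G →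
    (f (M[C₂ₙ] n 2≤n □ G) ≤ f (M[C₂ₙ] n 2≤n) * f G) ×
    (f (M[C₂ₙ] n 2≤n) * f G ≡ (2 ^ (n + 1) + 2 * n ∸ 2) * f G)
theorem3p8 zero       () G odd
theorem3p8 (suc zero) (s≤s ()) G odd
theorem3p8 (suc (suc m)) 2≤n G odd =
  ≤-trans (proj₂ (f-isPebblingNumber (M[C₂ₙ] n 2≤n □ G)) (order n * f G)
            (MiddleProduct.suffices-product m 2≤n G (f G) (proj₁ (f-isPebblingNumber G)) odd))
          (≤-reflexive (sym value)) ,
  value
  where
  n : ℕ
  n = suc (suc m)
  value : f (M[C₂ₙ] n 2≤n) * f G ≡ order n * f G
  value = cong (_* f G) (f-middle m 2≤n)
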